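{- There is an absolute constant $c>0$ such that for every $n$, every $\epsilon\in(0,1)$ and every symmetric PSD $A\in\mathbb{R}^{n\times n}$ with $\max_{i,j}|A_{ij}|\le 1$, Algorithm E run with $p=\min(1, \frac{c}{\epsilon n})$ returns, with probability at least $3/4$, a unit vector $u\in\mathbb{R}^n$ with $u^TAu \ge \lambda_1(A) - \epsilon n$, where $\lambda_1(A)$ is the largest eigenvalue of $A$.
   Context: Algorithm E: include each column index $i\in[n]$ independently with probability $p$; let $S\in\mathbb{R}^{n\times m}$ be the matrix whose columns are the standard basis vectors $e_i$ of the included indices. Query the columns $AS$ of $A$, and from $AS$ and $S$ compute $S^TAS$ and $S^TA^2S=(AS)^T(AS)$. If $S^TAS = 0$, return an arbitrary unit vector. Otherwise find $x\in\mathbb{R}^m$ with $x^TS^TASx>0$ maximizing $\frac{x^TS^TA^2Sx}{x^TS^TASx}$, and return $u = \frac{ASx}{\|ASx\|_2}$. -}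

module Defs where

open import Level using (Level; _⊔_; suc)
open import Algebra.Bundles using (CommutativeRing)
open import Algebra.Core using (Op₁; Op₂)
open import Algebra.Definitions using (Congruent₁)
open import Algebra.Structures using (IsCommutativeRing)
import Algebra.Construct.NaturalChoice.Max as Max
import Algebra.Construct.NaturalChoice.Min as Min
import Algebra.Definitions.RawMonoid as RawMonoidDefs
open import Data.Bool.Base using (if_then_else_)
open import Data.Fin.Base as Fin using (Fin)
open import Data.Fin.Properties using (_≟_)
open import Data.Fin.Subset using (Subset; inside; outside; ∣_∣)
open import Data.Nat.Base as ℕ using (ℕ)
open import Data.Product.Base using (∃; _×_)
open import Data.Vec.Base using ([]; _∷_)
open import Data.Vec.Functional using (Vector)
open import Relation.Binary.Bundles using (DecTotalOrder)
open import Relation.Binary.Core using (Rel)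
open import Relation.Binary.Structures using (IsDecTotalOrder)
import Relation.Binary.Construct.NonStrictToStrict as NonStrictToStrict
open import Relation.Nullary using (¬_; does)
open import Relation.Nullary.Decidable using (_×-dec_)
open import Relation.Unary using (Pred; Decidable)

-- The classical axioms for ℝ, which determine it up to isomorphism. They are
-- deliberately non-constructive: the order is decidable, and every inhabited
-- predicate that is bounded above has a least upper bound.
record CompleteOrderedField (a ℓ₁ ℓ₂ : Level) : Set (suc (a ⊔ ℓ₁ ⊔ ℓ₂)) where
  infix  8 _⁻¹
  infix  8 -_
  infixl 7 _*_
  infixl 6 _+_
  infix  4 _≈_ _≤_
  field
    Carrier : Set a
    _≈_     : Rel Carrier ℓ₁
    _≤_     : Rel Carrier ℓ₂
    _+_     : Op₂ Carrier
    _*_     : Op₂ Carrier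
    -_      : Op₁ Carrier
    0#      : Carrier
    1#      : Carrier
    -- Total; its value at 0# is unspecified.
    _⁻¹     : Op₁ Carrier

    isCommutativeRing : IsCommutativeRing _≈_ _+_ _*_ -_ 0# 1#
    0≉1               : ¬ (0# ≈ 1#)
    ⁻¹-cong           : Congruent₁ _≈_ _⁻¹
    *-inverseʳ        : ∀ x → ¬ (x ≈ 0#) → x * x ⁻¹ ≈ 1#

    isDecTotalOrder   : IsDecTotalOrder _≈_ _≤_
    +-monoʳ-≤         : ∀ x {y z} → y ≤ z → x + y ≤ x + z
    *-nonNegative     : ∀ {x y} → 0# ≤ x → 0# ≤ y → 0# ≤ x * y

  IsUpperBound : ∀ {p} → Pred Carrier p → Pred Carrier (a ⊔ ℓ₂ ⊔ p)
  IsUpperBound P b = ∀ x → P x → x ≤ b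

  IsSupremum : ∀ {p} → Pred Carrier p → Pred Carrier (a ⊔ ℓ₂ ⊔ p)
  IsSupremum P s = IsUpperBound P s × (∀ b → IsUpperBound P b → s ≤ b)

  field
    supremum : (P : Pred Carrier (a ⊔ ℓ₁ ⊔ ℓ₂)) →
               ∃ P → ∃ (IsUpperBound P) → ∃ (IsSupremum P)

  commutativeRing : CommutativeRing a ℓ₁
  commutativeRing = record { isCommutativeRing = isCommutativeRing }

  decTotalOrder : DecTotalOrder a ℓ₁ ℓ₂
  decTotalOrder = record { isDecTotalOrder = isDecTotalOrder }

  open CommutativeRing commutativeRing public using (_-_; +-rawMonoid)
  open DecTotalOrder decTotalOrder public using (_≤?_; totalOrder)
    renaming (_≟_ to _≈?_)
  open NonStrictToStrict _≈_ _≤_ public using (_<_)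
  open Min totalOrder public using (_⊓_)
  open Max totalOrder public using () renaming (_⊔_ to max)
  open RawMonoidDefs +-rawMonoid public using (sum) renaming (_×_ to _·_)

  infixl 7 _/_
  _/_ : Op₂ Carrier
  x / y = x * y ⁻¹

  fromℕ : ℕ → Carrier
  fromℕ k = k · 1#

  abs : Op₁ Carrier
  abs x = max x (- x)

module LinearAlgebra {a ℓ₁ ℓ₂} (ℝ : CompleteOrderedField a ℓ₁ ℓ₂) where
  open CompleteOrderedField ℝ

  Matrix : ℕ → ℕ → Set a
  Matrix m n = Fin m → Fin n → Carrier

  infixl 7 _∙_
  _∙_ : ∀ {n} → Vector Carrier n → Vector Carrier n → Carrier
  v ∙ w = sum (λ i → v i * w i)

  infixl 8 _⊠_
  _⊠_ : ∀ {l m n} → Matrix l m → Matrix m n → Matrix l n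
  (A ⊠ B) i k = sum (λ j → A i j * B j k)

  infixr 8 _⊡_
  _⊡_ : ∀ {m n} → Matrix m n → Vector Carrier n → Vector Carrier m
  (A ⊡ v) i = A i ∙ v

  infix 9 _ᵀ
  _ᵀ : ∀ {m n} → Matrix m n → Matrix n m
  (A ᵀ) i j = A j i

  quadraticForm : ∀ {n} → Matrix n n → Vector Carrier n → Carrier
  quadraticForm A x = x ∙ (A ⊡ x)

  -- r is ‖v‖₂, the nonnegative square root of v ∙ v.
  Is‖_‖₂ : ∀ {n} → Vector Carrier n → Pred Carrier (ℓ₁ ⊔ ℓ₂)
  Is‖ v ‖₂ r = 0# ≤ r × r * r ≈ v ∙ v

  IsUnit : ∀ {n} → Vector Carrier n → Set (ℓ₁ ⊔ ℓ₂)
  IsUnit v = Is‖ v ‖₂ 1#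

  IsZero : ∀ {m n} → Matrix m n → Set ℓ₁
  IsZero A = ∀ i j → A i j ≈ 0#

  IsSymmetric : ∀ {n} → Matrix n n → Set ℓ₁
  IsSymmetric A = ∀ i j → A i j ≈ A j i

  IsPSD : ∀ {n} → Matrix n n → Set (a ⊔ ℓ₂)
  IsPSD A = ∀ x → 0# ≤ quadraticForm A x

  IsEigenvalue : ∀ {n} → Matrix n n → Pred Carrier (a ⊔ ℓ₁)
  IsEigenvalue A μ =
    ∃ λ v → ¬ (∀ i → v i ≈ 0#) × (∀ i → (A ⊡ v) i ≈ μ * v i)

  IsLargestEigenvalue : ∀ {n} → Matrix n n → Pred Carrier (a ⊔ ℓ₁ ⊔ ℓ₂)
  IsLargestEigenvalue A μ = IsEigenvalue A μ × (∀ ν → IsEigenvalue A ν → ν ≤ μ)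

module Sampling {a ℓ₁ ℓ₂} (ℝ : CompleteOrderedField a ℓ₁ ℓ₂) where
  open CompleteOrderedField ℝ

  -- The probability that the included set is exactly T, when each index is
  -- included independently with probability p.
  mass : Carrier → ∀ {n} → Subset n → Carrier
  mass p []            = 1#
  mass p (inside  ∷ T) = p * mass p T
  mass p (outside ∷ T) = (1# - p) * mass p T

  sumSubsets : ∀ {n} → (Subset n → Carrier) → Carrier
  sumSubsets {ℕ.zero}  f = f []
  sumSubsets {ℕ.suc n} f =
    sumSubsets (λ T → f (inside ∷ T)) + sumSubsets (λ T → f (outside ∷ T))

  Probability : Carrier → ∀ {n e} {E : Pred (Subset n) e} → Decidable E → Carrier
  Probability p E? = sumSubsets (λ T → if does (E? T) then mass p T else 0#)

-- The increasing enumeration of the elements of T.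
element : ∀ {n} (T : Subset n) → Fin ∣ T ∣ → Fin n
element (inside  ∷ T) Fin.zero    = Fin.zero
element (inside  ∷ T) (Fin.suc k) = Fin.suc (element T k)
element (outside ∷ T) k           = Fin.suc (element T k)

module AlgorithmE {a ℓ₁ ℓ₂} (ℝ : CompleteOrderedField a ℓ₁ ℓ₂) where
  open CompleteOrderedField ℝ
  open LinearAlgebra ℝ

  selection : ∀ {n} (T : Subset n) → Matrix n ∣ T ∣
  selection T i k = if does (i ≟ element T k) then 1# else 0#

  module _ {n} (A : Matrix n n) (T : Subset n) where

    S AS : Matrix n ∣ T ∣
    S  = selection T
    AS = A ⊠ S

    SᵀAS SᵀA²S : Matrix ∣ T ∣ ∣ T ∣
    SᵀAS  = S ᵀ ⊠ AS
    SᵀA²S = AS ᵀ ⊠ AS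

    ratio : Vector Carrier ∣ T ∣ → Carrier
    ratio x = quadraticForm SᵀA²S x / quadraticForm SᵀAS x

    Admissible : Pred (Vector Carrier ∣ T ∣) (ℓ₁ ⊔ ℓ₂)
    Admissible x = 0# < quadraticForm SᵀAS x

    IsMaximizer : Pred (Vector Carrier ∣ T ∣) (a ⊔ ℓ₁ ⊔ ℓ₂)
    IsMaximizer x = Admissible x × (∀ y → Admissible y → ratio y ≤ ratio x)

    -- Returns u : the algorithm may return u when the included set is T. Both
    -- the arbitrary unit vector and the maximizer are left unspecified, so u
    -- need not be unique.
    data Returns (u : Vector Carrier n) : Set (a ⊔ ℓ₁ ⊔ ℓ₂) where
      arbitrary  : IsZero SᵀAS → IsUnit u → Returns u
      normalized : ¬ IsZero SᵀAS →
                   ∀ x → IsMaximizer x →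
                   ∀ r → Is‖ AS ⊡ x ‖₂ r →
                   (∀ i → u i ≈ (AS ⊡ x) i / r) → Returns u

module Guarantee {a ℓ₁ ℓ₂} (ℝ : CompleteOrderedField a ℓ₁ ℓ₂) where
  open CompleteOrderedField ℝ
  open LinearAlgebra ℝ

  IsUnitWithValue≥ : ∀ {n} → Matrix n n → Carrier → Pred (Vector Carrier n) (ℓ₁ ⊔ ℓ₂)
  IsUnitWithValue≥ A t u = IsUnit u × t ≤ quadraticForm A u

  isUnitWithValue≥? : ∀ {n} (A : Matrix n n) t → Decidable (IsUnitWithValue≥ A t)
  isUnitWithValue≥? A t u =
    ((0# ≤? 1#) ×-dec (1# * 1# ≈? u ∙ u)) ×-dec (t ≤? quadraticForm A u)

{-# OPTIONS --safe #-}

-- Let η = εn, let v be a unit eigenvector for λ₁, and let dᵢ = (1[i ∈ T] - p) vᵢ,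
-- so that y = d + pv is the restriction of v to T. Independence of the
-- coordinates gives E[dᵀAd] = p(1 - p) Σᵢ vᵢ² Aᵢᵢ ≤ p(1 - p). If 2 dᵀAd < ηp²,
-- then splitting y along v and its orthogonal complement shows that
-- yᵀA²y ≥ (λ₁ - η) yᵀAy; and the value uᵀAu of the output is at least the
-- maximal ratio, by Cauchy–Schwarz in the A-form. Markov's inequality then
-- bounds the failure probability by 2(1 - p)/(ηp), which is at most 1/4 for c = 8.
module Submission where

open import Defs
open import Data.Fin.Subset using (Subset)
open import Data.Nat.Base using (ℕ; NonZero)
open import Data.Product.Base using (∃; _×_)
open import Data.Vec.Functional using (Vector)

open import Algebra.Bundles using (CommutativeRing)
import Algebra.Construct.NaturalChoice.Max as Max
import Algebra.Construct.NaturalChoice.Min as Min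
import Algebra.Properties.AbelianGroup as AbelianGroupProperties
import Algebra.Properties.Ring as RingProperties
import Algebra.Properties.Semiring.Mult.TCOptimised as Mult
import Algebra.Properties.Semiring.Sum as SemiringSum
import Algebra.Solver.Ring as RingSolver
open import Algebra.Solver.Ring.AlmostCommutativeRing
  using (fromCommutativeRing; _-Raw-AlmostCommutative⟶_)
open import Data.Bool.Base using (if_then_else_)
open import Data.Fin.Base using (Fin; zero; suc)
open import Data.Fin.Properties using (_≟_; any?)
open import Data.Fin.Subset using (inside; outside; ∣_∣)
open import Data.Integer.Base as ℤ using (ℤ; +_; -[1+_])
import Data.Integer.Properties as ℤ
open import Data.Maybe.Base using (Maybe; nothing; just)
open import Data.Nat.Base as ℕ using (zero; suc)
import Data.Nat.Properties as ℕ
open import Data.Product.Base using (_,_; proj₁; proj₂)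
open import Data.Sum.Base using (_⊎_; inj₁; inj₂; [_,_]′)
open import Data.Vec.Base using ([]; _∷_)
open import Data.Vec.Functional using (head; tail) renaming (_∷_ to _∷ᶠ_)
open import Function.Base using (_∘_)
open import Level using (_⊔_; Lift; lift)
open import Relation.Binary.Bundles using (DecTotalOrder)
import Relation.Binary.PropositionalEquality.Core as ≡
import Relation.Binary.Reasoning.PartialOrder as PartialOrderReasoning
import Relation.Binary.Reasoning.Setoid as SetoidReasoning
open import Relation.Nullary using (¬_; yes; no; contradiction; does)
open import Relation.Nullary.Decidable using (¬?)
open import Relation.Unary using (Pred; Decidable)

-- The theorem also claims that every `T` has an output, so the maximal ratio must be attained
-- although `SᵀAS` may be singular. Attainment rests on the supremum axiom and on a
-- finite-dimensional dichotomy for two semi-inner products F and G: either some F-null vector has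
-- positive G-norm, or G is at most a constant times F. No compactness and no eigenbasis enter.
--
-- The delicate point of the splitting, with μ = λ₁ and b = d·v, is that the coefficient y·v = p + b
-- of v in y is random too and may even vanish. The A-form of the part of y orthogonal to v is q =
-- dᵀAd - μb², and the goal reduces to q ≤ η(p + b)². When b is near -p the right side is small, but
-- then μb² is subtracted on the left. The inequality 2b² + 2(p + b)² ≥ p² balances the two effects
-- and is the origin of the factor 2 in the condition on dᵀAd. The trade needs η ≤ μ; otherwise the
-- target μ - η is at most 0 and semidefiniteness suffices.
--
-- The constant 8: at p = 8/η the failure bound 2(1 - p)/(ηp) is at most 2/8, and at p = 1 it
-- vanishes.

module IntegerCoefficients {c ℓ} (R : CommutativeRing c ℓ) where
  open CommutativeRing R
  open AbelianGroupProperties +-abelianGroup using (⁻¹-involutive; ε⁻¹≈ε) renaming (⁻¹-∙-comm to -‿+-comm)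
  open RingProperties ring using (-‿distribˡ-*; -‿distribʳ-*)
  open Mult semiring renaming (_×_ to _·_)
  open SetoidReasoning setoid

  -- Interprets the integer coefficients of the ring solver. With the optimised multiple,
  -- `con (+ 0)` and `con (+ 1)` evaluate to `0#` and `1#` definitionally, so solved identities
  -- match goals that mention these constants.
  fromℤ : ℤ → Carrier
  fromℤ (+ n)    = n · 1#
  fromℤ -[1+ n ] = - (suc n · 1#)

  x+y-[x+z]≈y-z : ∀ x y z → (x + y) - (x + z) ≈ y - z
  x+y-[x+z]≈y-z x y z = begin
    (x + y) + - (x + z)     ≈⟨ +-cong (+-comm x y) (sym (-‿+-comm x z)) ⟩
    (y + x) + (- x + - z)   ≈⟨ +-assoc y x _ ⟩
    y + (x + (- x + - z))   ≈⟨ +-congˡ (+-assoc x (- x) (- z)) ⟨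
    y + ((x + - x) + - z)   ≈⟨ +-congˡ (+-congʳ (-‿inverseʳ x)) ⟩
    y + (0# + - z)          ≈⟨ +-congˡ (+-identityˡ (- z)) ⟩
    y + - z                 ∎

  fromℤ-⊖ : ∀ m n → fromℤ (m ℤ.⊖ n) ≈ m · 1# - n · 1#
  fromℤ-⊖ m       zero    = sym (trans (+-congˡ ε⁻¹≈ε) (+-identityʳ _))
  fromℤ-⊖ zero    (suc n) = sym (+-identityˡ _)
  fromℤ-⊖ (suc m) (suc n) = begin
    fromℤ (suc m ℤ.⊖ suc n)             ≡⟨ ≡.cong fromℤ (ℤ.[1+m]⊖[1+n]≡m⊖n m n) ⟩
    fromℤ (m ℤ.⊖ n)                     ≈⟨ fromℤ-⊖ m n ⟩
    m · 1# - n · 1#                     ≈⟨ x+y-[x+z]≈y-z 1# _ _ ⟨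
    (1# + m · 1#) - (1# + n · 1#)       ≈⟨ +-cong (1+× m 1#) (-‿cong (1+× n 1#)) ⟨
    suc m · 1# - suc n · 1#             ∎

  fromℤ-homo-+ : ∀ i j → fromℤ (i ℤ.+ j) ≈ fromℤ i + fromℤ j
  fromℤ-homo-+ (+ m)    (+ n)    = ×-homo-+ 1# m n
  fromℤ-homo-+ (+ m)    -[1+ n ] = fromℤ-⊖ m (suc n)
  fromℤ-homo-+ -[1+ m ] (+ n)    = trans (fromℤ-⊖ n (suc m)) (+-comm _ _)
  fromℤ-homo-+ -[1+ m ] -[1+ n ] = begin
    - (suc (suc (m ℕ.+ n)) · 1#)        ≡⟨ ≡.cong (λ k → - (suc k · 1#)) (ℕ.+-suc m n) ⟨
    - ((suc m ℕ.+ suc n) · 1#)          ≈⟨ -‿cong (×-homo-+ 1# (suc m) (suc n)) ⟩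
    - (suc m · 1# + suc n · 1#)         ≈⟨ -‿+-comm _ _ ⟨
    - (suc m · 1#) + - (suc n · 1#)     ∎

  fromℤ-homo-neg : ∀ i → fromℤ (ℤ.- i) ≈ - fromℤ i
  fromℤ-homo-neg (+ zero)  = sym ε⁻¹≈ε
  fromℤ-homo-neg (+ suc n) = refl
  fromℤ-homo-neg -[1+ n ]  = sym (⁻¹-involutive _)

  fromℤ-homo-+* : ∀ m j → fromℤ (+ m ℤ.* j) ≈ fromℤ (+ m) * fromℤ j
  fromℤ-homo-+* m (+ n) = begin
    fromℤ (+ m ℤ.* + n)      ≡⟨ ≡.cong fromℤ (ℤ.pos-* m n) ⟨
    (m ℕ.* n) · 1#           ≈⟨ ×1-homo-* m n ⟩
    (m · 1#) * (n · 1#)      ∎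
  fromℤ-homo-+* m -[1+ n ] = begin
    fromℤ (+ m ℤ.* -[1+ n ])         ≡⟨ ≡.cong fromℤ (ℤ.neg-distribʳ-* (+ m) (+ suc n)) ⟨
    fromℤ (ℤ.- (+ m ℤ.* + suc n))    ≈⟨ fromℤ-homo-neg (+ m ℤ.* + suc n) ⟩
    - fromℤ (+ m ℤ.* + suc n)        ≡⟨ ≡.cong (λ i → - fromℤ i) (ℤ.pos-* m (suc n)) ⟨
    - ((m ℕ.* suc n) · 1#)           ≈⟨ -‿cong (×1-homo-* m (suc n)) ⟩
    - ((m · 1#) * (suc n · 1#))      ≈⟨ -‿distribʳ-* _ _ ⟩
    (m · 1#) * - (suc n · 1#)        ∎

  fromℤ-homo-* : ∀ i j → fromℤ (i ℤ.* j) ≈ fromℤ i * fromℤ j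
  fromℤ-homo-* (+ m)    j = fromℤ-homo-+* m j
  fromℤ-homo-* -[1+ m ] j = begin
    fromℤ (-[1+ m ] ℤ.* j)           ≡⟨ ≡.cong fromℤ (ℤ.neg-distribˡ-* (+ suc m) j) ⟨
    fromℤ (ℤ.- (+ suc m ℤ.* j))      ≈⟨ fromℤ-homo-neg (+ suc m ℤ.* j) ⟩
    - fromℤ (+ suc m ℤ.* j)          ≈⟨ -‿cong (fromℤ-homo-+* (suc m) j) ⟩
    - ((suc m · 1#) * fromℤ j)       ≈⟨ -‿distribˡ-* _ _ ⟩
    - (suc m · 1#) * fromℤ j         ∎

  fromℤ-morphism : ℤ.+-*-rawRing -Raw-AlmostCommutative⟶ fromCommutativeRing R
  fromℤ-morphism = record
    { ⟦_⟧    = fromℤ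
    ; +-homo = fromℤ-homo-+
    ; *-homo = fromℤ-homo-*
    ; -‿homo = fromℤ-homo-neg
    ; 0-homo = refl
    ; 1-homo = refl
    }

  coefficient≟ : ∀ i j → Maybe (fromℤ i ≈ fromℤ j)
  coefficient≟ i j with i ℤ.≟ j
  ... | yes i≡j = just (reflexive (≡.cong fromℤ i≡j))
  ... | no  _   = nothing

  open RingSolver ℤ.+-*-rawRing (fromCommutativeRing R) fromℤ-morphism coefficient≟ public
    using (solve; _:=_; _:+_; _:*_; :-_; _:-_; con)

-- Ordered field arithmetic and square roots.

module OrderedField {a ℓ₁ ℓ₂} (ℝ : CompleteOrderedField a ℓ₁ ℓ₂) where
  open CompleteOrderedField ℝ public
  open CommutativeRing commutativeRing public
    using ( refl; sym; trans
          ; +-cong; +-congˡ; +-congʳ; +-comm; +-identityˡ; +-identityʳ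
          ; *-cong; *-congˡ; *-congʳ; *-comm; *-assoc; *-identityˡ; *-identityʳ
          ; distribˡ; zeroˡ; zeroʳ; -‿cong; -‿inverseʳ; -‿inverseˡ
          ; semiring )
  open DecTotalOrder decTotalOrder public
    using (≤-respˡ-≈; ≤-respʳ-≈; poset)
    renaming ( refl to ≤-refl; trans to ≤-trans; antisym to ≤-antisym
             ; total to ≤-total; reflexive to ≤-reflexive )
  open IntegerCoefficients commutativeRing public using (solve; _:=_; _:+_; _:*_; :-_; _:-_; con)
  open PartialOrderReasoning poset public

  0≤y-x⇒x≤y : ∀ {x y} → 0# ≤ y - x → x ≤ y
  0≤y-x⇒x≤y {x} {y} 0≤ = begin
    x              ≈⟨ +-identityʳ x ⟨
    x + 0#         ≤⟨ +-monoʳ-≤ x 0≤ ⟩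
    x + (y - x)    ≈⟨ solve 2 (λ x y → x :+ (y :- x) := y) refl x y ⟩
    y              ∎

  x≤y⇒0≤y-x : ∀ {x y} → x ≤ y → 0# ≤ y - x
  x≤y⇒0≤y-x {x} {y} x≤y = begin
    0#             ≈⟨ -‿inverseˡ x ⟨
    - x + x        ≤⟨ +-monoʳ-≤ (- x) x≤y ⟩
    - x + y        ≈⟨ +-comm (- x) y ⟩
    y - x          ∎

  -- The certificate pattern behind the polynomial inequalities of the development: a visibly
  -- nonnegative `z` is exhibited, and the solver checks that it is the difference of the two sides.
  ≤-by : ∀ {x y z} → 0# ≤ z → z ≈ y - x → x ≤ y
  ≤-by 0≤z z≈ = 0≤y-x⇒x≤y (≤-respʳ-≈ z≈ 0≤z)

  +-nonNegative : ∀ {x y} → 0# ≤ x → 0# ≤ y → 0# ≤ x + y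
  +-nonNegative {x} {y} 0≤x 0≤y = begin
    0#        ≤⟨ 0≤x ⟩
    x         ≈⟨ +-identityʳ x ⟨
    x + 0#    ≤⟨ +-monoʳ-≤ x 0≤y ⟩
    x + y     ∎

  +-mono-≤ : ∀ {x y u v} → x ≤ y → u ≤ v → x + u ≤ y + v
  +-mono-≤ {x} {y} {u} {v} x≤y u≤v =
    ≤-by (+-nonNegative (x≤y⇒0≤y-x x≤y) (x≤y⇒0≤y-x u≤v))
      (solve 4 (λ x y u v → (y :- x) :+ (v :- u) := (y :+ v) :- (x :+ u)) refl x y u v)

  *-monoˡ-≤ : ∀ {x y z} → 0# ≤ z → x ≤ y → z * x ≤ z * y
  *-monoˡ-≤ {x} {y} {z} 0≤z x≤y =
    ≤-by (*-nonNegative 0≤z (x≤y⇒0≤y-x x≤y))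
      (solve 3 (λ x y z → z :* (y :- x) := z :* y :- z :* x) refl x y z)

  *-monoʳ-≤ : ∀ {x y z} → 0# ≤ z → x ≤ y → x * z ≤ y * z
  *-monoʳ-≤ {x} {y} {z} 0≤z x≤y = begin
    x * z    ≈⟨ *-comm x z ⟩
    z * x    ≤⟨ *-monoˡ-≤ 0≤z x≤y ⟩
    z * y    ≈⟨ *-comm z y ⟩
    y * z    ∎

  x≤0⇒0≤-x : ∀ {x} → x ≤ 0# → 0# ≤ - x
  x≤0⇒0≤-x x≤0 = ≤-respʳ-≈ (+-identityˡ _) (x≤y⇒0≤y-x x≤0)

  ≰⇒≥ : ∀ {x y} → ¬ (x ≤ y) → y ≤ x
  ≰⇒≥ {x} {y} x≰y with ≤-total x y
  ... | inj₁ x≤y = contradiction x≤y x≰y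
  ... | inj₂ y≤x = y≤x

  ≰⇒> : ∀ {x y} → ¬ (x ≤ y) → y < x
  ≰⇒> x≰y = ≰⇒≥ x≰y , λ y≈x → x≰y (≤-reflexive (sym y≈x))

  <⇒≤ : ∀ {x y} → x < y → x ≤ y
  <⇒≤ = proj₁

  <⇒≱ : ∀ {x y} → x < y → ¬ (y ≤ x)
  <⇒≱ (x≤y , x≉y) y≤x = x≉y (≤-antisym x≤y y≤x)

  ≈0-or->0 : ∀ {x} → 0# ≤ x → x ≈ 0# ⊎ 0# < x
  ≈0-or->0 {x} 0≤x with x ≤? 0#
  ... | yes x≤0 = inj₁ (≤-antisym x≤0 0≤x)
  ... | no  x≰0 = inj₂ (≰⇒> x≰0)

  >⇒≉0 : ∀ {x} → 0# < x → ¬ (x ≈ 0#)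
  >⇒≉0 (_ , 0≉x) x≈0 = 0≉x (sym x≈0)

  square-nonNegative : ∀ x → 0# ≤ x * x
  square-nonNegative x with ≤-total 0# x
  ... | inj₁ 0≤x = *-nonNegative 0≤x 0≤x
  ... | inj₂ x≤0 = ≤-respʳ-≈ (solve 1 (λ x → :- x :* :- x := x :* x) refl x)
                     (*-nonNegative (x≤0⇒0≤-x x≤0) (x≤0⇒0≤-x x≤0))

  0≤1 : 0# ≤ 1#
  0≤1 = ≤-respʳ-≈ (*-identityˡ 1#) (square-nonNegative 1#)

  0<1 : 0# < 1#
  0<1 = 0≤1 , 0≉1

  *-inverseˡ : ∀ x → ¬ (x ≈ 0#) → x ⁻¹ * x ≈ 1#
  *-inverseˡ x x≉0 = trans (*-comm _ _) (*-inverseʳ x x≉0)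

  ⁻¹-nonNegative : ∀ {x} → 0# < x → 0# ≤ x ⁻¹
  ⁻¹-nonNegative {x} 0<x with ≤-total 0# (x ⁻¹)
  ... | inj₁ 0≤x⁻¹ = 0≤x⁻¹
  ... | inj₂ x⁻¹≤0 = contradiction
    (begin
      1#         ≈⟨ *-inverseʳ x (>⇒≉0 0<x) ⟨
      x * x ⁻¹   ≤⟨ *-monoˡ-≤ (<⇒≤ 0<x) x⁻¹≤0 ⟩
      x * 0#     ≈⟨ zeroʳ x ⟩
      0#         ∎)
    (<⇒≱ 0<1)

  *-cancelˡ-≤ : ∀ {x y z} → 0# < z → z * x ≤ z * y → x ≤ y
  *-cancelˡ-≤ {x} {y} {z} 0<z zx≤zy = begin
    x                ≈⟨ lemma x ⟨
    z ⁻¹ * (z * x)   ≤⟨ *-monoˡ-≤ (⁻¹-nonNegative 0<z) zx≤zy ⟩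
    z ⁻¹ * (z * y)   ≈⟨ lemma y ⟩
    y                ∎
    where
    lemma : ∀ x → z ⁻¹ * (z * x) ≈ x
    lemma x = trans (sym (*-assoc _ _ _)) (trans (*-congʳ (*-inverseˡ z (>⇒≉0 0<z))) (*-identityˡ x))

  *-nonNegative⁻¹ : ∀ {x z} → 0# < z → 0# ≤ z * x → 0# ≤ x
  *-nonNegative⁻¹ 0<z 0≤zx = *-cancelˡ-≤ 0<z (≤-respˡ-≈ (sym (zeroʳ _)) 0≤zx)

  x*y≈0⇒y≈0 : ∀ {x y} → ¬ (x ≈ 0#) → x * y ≈ 0# → y ≈ 0#
  x*y≈0⇒y≈0 {x} {y} x≉0 xy≈0 = begin-equality
    y                ≈⟨ *-identityˡ y ⟨
    1# * y           ≈⟨ *-congʳ (*-inverseˡ x x≉0) ⟨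
    x ⁻¹ * x * y     ≈⟨ *-assoc _ _ _ ⟩
    x ⁻¹ * (x * y)   ≈⟨ *-congˡ xy≈0 ⟩
    x ⁻¹ * 0#        ≈⟨ zeroʳ _ ⟩
    0#               ∎

  *-positive : ∀ {x y} → 0# < x → 0# < y → 0# < x * y
  *-positive 0<x 0<y = *-nonNegative (<⇒≤ 0<x) (<⇒≤ 0<y) ,
    λ 0≈xy → >⇒≉0 0<y (x*y≈0⇒y≈0 (>⇒≉0 0<x) (sym 0≈xy))

  ⁻¹-positive : ∀ {x} → 0# < x → 0# < x ⁻¹
  ⁻¹-positive {x} 0<x = ⁻¹-nonNegative 0<x ,
    λ 0≈x⁻¹ → 0≉1 (trans (sym (zeroʳ x)) (trans (*-congˡ 0≈x⁻¹) (*-inverseʳ x (>⇒≉0 0<x))))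

  +-positive : ∀ {x y} → 0# < x → 0# ≤ y → 0# < x + y
  +-positive {x} {y} 0<x 0≤y = ≰⇒> λ x+y≤0 → <⇒≱ 0<x
    (begin
      x         ≈⟨ +-identityʳ x ⟨
      x + 0#    ≤⟨ +-monoʳ-≤ x 0≤y ⟩
      x + y     ≤⟨ x+y≤0 ⟩
      0#        ∎)

  x*x≤0⇒x≈0 : ∀ {x} → x * x ≤ 0# → x ≈ 0#
  x*x≤0⇒x≈0 {x} xx≤0 with x ≈? 0#
  ... | yes x≈0 = x≈0
  ... | no  x≉0 = contradiction (x*y≈0⇒y≈0 x≉0 (≤-antisym xx≤0 (square-nonNegative x))) x≉0

  <-respʳ-≈ : ∀ {x y z} → y ≈ z → x < y → x < z
  <-respʳ-≈ y≈z (x≤y , x≉y) = ≤-respʳ-≈ y≈z x≤y , λ x≈z → x≉y (trans x≈z (sym y≈z))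

  x<y⇒0<y-x : ∀ {x y} → x < y → 0# < y - x
  x<y⇒0<y-x {x} {y} x<y = ≰⇒> λ y-x≤0 → <⇒≱ x<y
    (≤-by (x≤0⇒0≤-x y-x≤0) (solve 2 (λ x y → :- (y :- x) := x :- y) refl x y))

  0<y-x⇒x<y : ∀ {x y} → 0# < y - x → x < y
  0<y-x⇒x<y {x} {y} 0<y-x = ≰⇒> λ y≤x → <⇒≱ 0<y-x
    (≤-by (x≤y⇒0≤y-x y≤x) (solve 2 (λ x y → x :- y := con (+ 0) :- (y :- x)) refl x y))

  x<x+h : ∀ x {h} → 0# < h → x < x + h
  x<x+h x {h} 0<h = 0<y-x⇒x<y (<-respʳ-≈ (solve 2 (λ x h → h := (x :+ h) :- x) refl x h) 0<h)

  x-h<x : ∀ x {h} → 0# < h → x - h < x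
  x-h<x x {h} 0<h = 0<y-x⇒x<y (<-respʳ-≈ (solve 2 (λ x h → h := x :- (x :- h)) refl x h) 0<h)

  x*[x⁻¹*y]≈y : ∀ {x y} → ¬ (x ≈ 0#) → x * (x ⁻¹ * y) ≈ y
  x*[x⁻¹*y]≈y {x} {y} x≉0 = begin-equality
    x * (x ⁻¹ * y)   ≈⟨ *-assoc _ _ _ ⟨
    x * x ⁻¹ * y     ≈⟨ *-congʳ (*-inverseʳ x x≉0) ⟩
    1# * y           ≈⟨ *-identityˡ y ⟩
    y                ∎

  square-cancel-≤ : ∀ {x y} → 0# ≤ y → x * x ≤ y * y → x ≤ y
  square-cancel-≤ {x} {y} 0≤y xx≤yy with x ≤? y
  ... | yes x≤y = x≤y
  ... | no  x≰y = contradiction xx≤yy (<⇒≱ (0<y-x⇒x<y (<-respʳ-≈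
          (solve 2 (λ x y → (x :- y) :* ((x :- y) :+ (y :+ y)) := x :* x :- y :* y) refl x y)
          (*-positive 0<x-y (+-positive 0<x-y (+-nonNegative 0≤y 0≤y))))))
    where
    0<x-y : 0# < x - y
    0<x-y = x<y⇒0<y-x (≰⇒> x≰y)

  fromℕ-nonNegative : ∀ k → 0# ≤ fromℕ k
  fromℕ-nonNegative zero    = ≤-refl
  fromℕ-nonNegative (suc k) = +-nonNegative 0≤1 (fromℕ-nonNegative k)

  fromℕ-positive : ∀ k .{{_ : NonZero k}} → 0# < fromℕ k
  fromℕ-positive (suc k) = +-positive 0<1 (fromℕ-nonNegative k)

  -- The root is the supremum t of the r ≥ 0 with r² ≤ s. If t² > s a smaller upper bound exists,
  -- and if t² < s a larger member exists.
  sqrt : ∀ {s} → 0# ≤ s → ∃ λ r → 0# ≤ r × r * r ≈ s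
  sqrt {s} 0≤s = t , 0≤t , ≤-antisym tt≤s s≤tt
    where
    P : Carrier → Set (a ⊔ ℓ₁ ⊔ ℓ₂)
    -- The lift only adjusts the universe level to the one at which `supremum` accepts predicates.
    P r = Lift (a ⊔ ℓ₁ ⊔ ℓ₂) (0# ≤ r × r * r ≤ s)

    P0 : P 0#
    P0 = lift (≤-refl , ≤-respˡ-≈ (sym (zeroʳ 0#)) 0≤s)

    s+1-upper : IsUpperBound P (s + 1#)
    s+1-upper r (lift (0≤r , rr≤s)) = square-cancel-≤ (+-nonNegative 0≤s 0≤1)
      (≤-trans rr≤s (≤-by (+-nonNegative (+-nonNegative (square-nonNegative s) 0≤s) 0≤1)
         (solve 1 (λ s → s :* s :+ s :+ con (+ 1) := (s :+ con (+ 1)) :* (s :+ con (+ 1)) :- s) refl s)))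

    sup = supremum P (0# , P0) (s + 1# , s+1-upper)
    t = proj₁ sup
    upper = proj₁ (proj₂ sup)
    least = proj₂ (proj₂ sup)

    0≤t : 0# ≤ t
    0≤t = upper 0# P0

    tt≤s : t * t ≤ s
    tt≤s with t * t ≤? s
    ... | yes tt≤s = tt≤s
    ... | no  tt≰s = contradiction (least (t - h) t-h-upper) (<⇒≱ (x-h<x t 0<h))
      where
      0<t : 0# < t
      0<t with ≈0-or->0 0≤t
      ... | inj₂ 0<t = 0<t
      ... | inj₁ t≈0 = contradiction (≤-respˡ-≈ (sym (trans (*-congʳ t≈0) (zeroˡ t))) 0≤s) tt≰s
      0<2t : 0# < t + t
      0<2t = +-positive 0<t 0≤t
      -- A Newton step: (t - h)² = s + h² ≥ s, so t - h still bounds the set from above.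
      h = (t + t) ⁻¹ * (t * t - s)
      2th : (t + t) * h ≈ t * t - s
      2th = x*[x⁻¹*y]≈y (>⇒≉0 0<2t)
      0<h : 0# < h
      0<h = *-positive (⁻¹-positive 0<2t) (x<y⇒0<y-x (≰⇒> tt≰s))
      0≤t-h : 0# ≤ t - h
      0≤t-h = *-nonNegative⁻¹ 0<2t (≤-respʳ-≈ (begin-equality
        t * t + s
            ≈⟨ solve 2 (λ t s → t :* t :+ s := (t :+ t) :* t :- (t :* t :- s)) refl t s ⟩
        (t + t) * t - (t * t - s)   ≈⟨ +-congˡ (-‿cong 2th) ⟨
        (t + t) * t - (t + t) * h   ≈⟨ solve 2 (λ t h → (t :+ t) :* t :- (t :+ t) :* h :=
            (t :+ t) :* (t :- h)) refl t h ⟩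
        (t + t) * (t - h)           ∎) (+-nonNegative (square-nonNegative t) 0≤s))
      t-h-upper : IsUpperBound P (t - h)
      t-h-upper r (lift (0≤r , rr≤s)) = square-cancel-≤ 0≤t-h
          (≤-trans rr≤s (≤-by (square-nonNegative h) (begin-equality
        h * h
            ≈⟨ solve 3 (λ t s h → h :* h := (t :* t :- (t :* t :- s) :+ h :* h) :- s) refl t s h ⟩
        (t * t - (t * t - s) + h * h) - s     ≈⟨ +-congʳ (+-congʳ (+-congˡ (-‿cong 2th))) ⟨
        (t * t - (t + t) * h + h * h) - s
            ≈⟨ solve 3 (λ t s h → (t :* t :- (t :+ t) :* h :+ h :* h) :- s := (t :- h) :* (t :- h) :- s)
                refl t s h ⟩
        (t - h) * (t - h) - s                 ∎)))

    s≤tt : s ≤ t * t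
    s≤tt with s ≤? t * t
    ... | yes s≤tt = s≤tt
    ... | no  s≰tt = contradiction (upper (t + h) (lift (+-nonNegative 0≤t (<⇒≤ 0<h) , [t+h]²≤s)))
                       (<⇒≱ (x<x+h t 0<h))
      where
      -- The summand s ensures e ≥ s - t², hence h ≤ 1. Then 2t + h ≤ 2t + 1 ≤ e, so (t + h)² ≤ t² +
      -- eh = s.
      e = s + (t + t + 1#)
      0<e : 0# < e
      0<e = <-respʳ-≈ (solve 2 (λ s t → con (+ 1) :+ (s :+ (t :+ t)) := s :+ (t :+ t :+ con (+ 1))) refl s t)
              (+-positive 0<1 (+-nonNegative 0≤s (+-nonNegative 0≤t 0≤t)))
      h = e ⁻¹ * (s - t * t)
      eh : e * h ≈ s - t * t
      eh = x*[x⁻¹*y]≈y (>⇒≉0 0<e)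
      0<h : 0# < h
      0<h = *-positive (⁻¹-positive 0<e) (x<y⇒0<y-x (≰⇒> s≰tt))
      h≤1 : h ≤ 1#
      h≤1 = *-cancelˡ-≤ 0<e
          (≤-by (+-nonNegative (square-nonNegative t) (+-nonNegative (+-nonNegative 0≤t 0≤t) 0≤1))
          (begin-equality
        t * t + (t + t + 1#)     ≈⟨ solve 2 (λ s t → t :* t :+ (t :+ t :+ con (+ 1)) :=
            (s :+ (t :+ t :+ con (+ 1))) :* con (+ 1) :- (s :- t :* t)) refl s t ⟩
        e * 1# - (s - t * t)     ≈⟨ +-congˡ (-‿cong eh) ⟨
        e * 1# - e * h           ∎))
      [t+h]²≤s : (t + h) * (t + h) ≤ s
      [t+h]²≤s = ≤-by (*-nonNegative (<⇒≤ 0<h) (+-nonNegative 0≤s (x≤y⇒0≤y-x h≤1))) (begin-equality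
        h * (s + (1# - h))
            ≈⟨ solve 3 (λ t s h → h :* (s :+ (con (+ 1) :- h)) :=
                t :* t :+ (s :+ (t :+ t :+ con (+ 1))) :* h :- (t :+ h) :* (t :+ h)) refl t s h ⟩
        t * t + e * h - (t + h) * (t + h)         ≈⟨ +-congʳ (+-congˡ eh) ⟩
        t * t + (s - t * t) - (t + h) * (t + h)
            ≈⟨ solve 3 (λ t s h → t :* t :+ (s :- t :* t) :- (t :+ h) :* (t :+ h) :=
                s :- (t :+ h) :* (t :+ h)) refl t s h ⟩
        s - (t + h) * (t + h)                     ∎)

-- Sums, matrices and semi-inner products.

module SemiInnerProducts {a ℓ₁ ℓ₂} (ℝ : CompleteOrderedField a ℓ₁ ℓ₂) where
  open OrderedField ℝ
  open LinearAlgebra ℝ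
  open SemiringSum semiring public
    using (sum-cong-≋; ∑-distrib-+; ∑-comm; *-distribˡ-sum; *-distribʳ-sum; sum-replicate-zero)

  infix 4 _≋_
  _≋_ : ∀ {n} → Vector Carrier n → Vector Carrier n → Set ℓ₁
  x ≋ y = ∀ i → x i ≈ y i

  lincomb : ∀ {n} → Carrier → Vector Carrier n → Carrier → Vector Carrier n → Vector Carrier n
  lincomb s x t y i = s * x i + t * y i

  sum-linear : ∀ {n} s (x : Vector Carrier n) t y → sum (lincomb s x t y) ≈ s * sum x + t * sum y
  sum-linear s x t y = trans (∑-distrib-+ (λ i → s * x i) (λ i → t * y i))
    (sym (+-cong (*-distribˡ-sum s x) (*-distribˡ-sum t y)))

  sum-mono-≤ : ∀ {n} {x y : Vector Carrier n} → (∀ i → x i ≤ y i) → sum x ≤ sum y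
  sum-mono-≤ {zero}  x≤y = ≤-refl
  sum-mono-≤ {suc n} x≤y = +-mono-≤ (x≤y zero) (sum-mono-≤ (x≤y ∘ suc))

  sum-nonNegative : ∀ {n} {x : Vector Carrier n} → (∀ i → 0# ≤ x i) → 0# ≤ sum x
  sum-nonNegative {zero}  0≤x = ≤-refl
  sum-nonNegative {suc n} 0≤x = +-nonNegative (0≤x zero) (sum-nonNegative (0≤x ∘ suc))

  ∙-cong : ∀ {n} {x x′ y y′ : Vector Carrier n} → x ≋ x′ → y ≋ y′ → x ∙ y ≈ x′ ∙ y′
  ∙-cong x≋x′ y≋y′ = sum-cong-≋ (λ i → *-cong (x≋x′ i) (y≋y′ i))

  ∙-comm : ∀ {n} (x y : Vector Carrier n) → x ∙ y ≈ y ∙ x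
  ∙-comm x y = sum-cong-≋ (λ i → *-comm (x i) (y i))

  ∙-linearˡ : ∀ {n} s (x : Vector Carrier n) t y z → lincomb s x t y ∙ z ≈ s * (x ∙ z) + t * (y ∙ z)
  ∙-linearˡ s x t y z = trans
    (sum-cong-≋ λ i → solve 5 (λ s t x y z → (s :* x :+ t :* y) :* z := s :* (x :* z) :+ t :* (y :* z))
        refl s t (x i) (y i) (z i))
    (sum-linear s (λ i → x i * z i) t (λ i → y i * z i))

  ∙-linearʳ : ∀ {n} s (x : Vector Carrier n) t y z → z ∙ lincomb s x t y ≈ s * (z ∙ x) + t * (z ∙ y)
  ∙-linearʳ s x t y z = trans (∙-comm z _) (trans (∙-linearˡ s x t y z)
    (+-cong (*-congˡ (∙-comm x z)) (*-congˡ (∙-comm y z))))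

  ∙-scaleʳ : ∀ {n} s (x : Vector Carrier n) z → z ∙ (λ i → s * x i) ≈ s * (z ∙ x)
  ∙-scaleʳ s x z = trans
    (sum-cong-≋ λ i → solve 3 (λ s x z → z :* (s :* x) := s :* (z :* x)) refl s (x i) (z i))
    (sym (*-distribˡ-sum s (λ i → z i * x i)))

  ⊡-cong : ∀ {m n} (M : Matrix m n) {x y : Vector Carrier n} → x ≋ y → M ⊡ x ≋ M ⊡ y
  ⊡-cong M x≋y i = ∙-cong (λ _ → refl) x≋y

  ⊡-linear : ∀ {m n} (M : Matrix m n) s x t y → M ⊡ lincomb s x t y ≋ lincomb s (M ⊡ x) t (M ⊡ y)
  ⊡-linear M s x t y i = ∙-linearʳ s x t y (M i)

  ∙-⊡-adjoint : ∀ {m n} (M : Matrix m n) x y → x ∙ (M ⊡ y) ≈ (M ᵀ ⊡ x) ∙ y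
  ∙-⊡-adjoint M x y = begin-equality
    sum (λ i → x i * sum (λ j → M i j * y j))
        ≈⟨ sum-cong-≋ (λ i → *-distribˡ-sum (x i) (λ j → M i j * y j)) ⟩
    sum (λ i → sum (λ j → x i * (M i j * y j)))    ≈⟨ ∑-comm (λ i j → x i * (M i j * y j)) ⟩
    sum (λ j → sum (λ i → x i * (M i j * y j)))
        ≈⟨ sum-cong-≋ (λ j → sum-cong-≋ λ i →
             solve 3 (λ x m y → x :* (m :* y) := (m :* x) :* y) refl (x i) (M i j) (y j)) ⟩
    sum (λ j → sum (λ i → M i j * x i * y j))
        ≈⟨ sum-cong-≋ (λ j → *-distribʳ-sum (y j) (λ i → M i j * x i)) ⟨
    sum (λ j → sum (λ i → M i j * x i) * y j)      ∎

  ⊠-⊡-assoc : ∀ {l m n} (M : Matrix l m) (N : Matrix m n) x → (M ⊠ N) ⊡ x ≋ M ⊡ (N ⊡ x)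
  ⊠-⊡-assoc M N x i = sym (trans (∙-⊡-adjoint N (M i) x)
    (∙-cong (λ k → ∙-comm (λ j → N j k) (M i)) (λ _ → refl)))

  record LinearMap (m n : ℕ) : Set (a ⊔ ℓ₁) where
    field
      map    : Vector Carrier m → Vector Carrier n
      cong   : ∀ {x y} → x ≋ y → map x ≋ map y
      linear : ∀ s x t y → map (lincomb s x t y) ≋ lincomb s (map x) t (map y)

  matrixMap : ∀ {m n} → Matrix m n → LinearMap n m
  matrixMap M = record { map = M ⊡_ ; cong = ⊡-cong M ; linear = ⊡-linear M }

  -- Abstract forms rather than matrices: the same lemmas then serve the dot product, the A-form,
  -- their pullbacks along S and AS, and differences μF - G, and an induction on dimension can
  -- restrict a form along a linear map.
  record SemiInnerProduct (n : ℕ) : Set (a ⊔ ℓ₁ ⊔ ℓ₂) where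
    field
      ⟨_,_⟩       : Vector Carrier n → Vector Carrier n → Carrier
      cong        : ∀ {x x′ y y′} → x ≋ x′ → y ≋ y′ → ⟨ x , y ⟩ ≈ ⟨ x′ , y′ ⟩
      comm        : ∀ x y → ⟨ x , y ⟩ ≈ ⟨ y , x ⟩
      linearˡ     : ∀ s x t y z → ⟨ lincomb s x t y , z ⟩ ≈ s * ⟨ x , z ⟩ + t * ⟨ y , z ⟩
      nonNegative : ∀ x → 0# ≤ ⟨ x , x ⟩

    linearʳ : ∀ s x t y z → ⟨ z , lincomb s x t y ⟩ ≈ s * ⟨ z , x ⟩ + t * ⟨ z , y ⟩
    linearʳ s x t y z = trans (comm _ _) (trans (linearˡ s x t y z)
      (+-cong (*-congˡ (comm x z)) (*-congˡ (comm y z))))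

    norm-lincomb : ∀ s x t y → ⟨ lincomb s x t y , lincomb s x t y ⟩ ≈
                   s * s * ⟨ x , x ⟩ + (s * t + s * t) * ⟨ x , y ⟩ + t * t * ⟨ y , y ⟩
    norm-lincomb s x t y = begin-equality
      ⟨ z , z ⟩                                ≈⟨ linearˡ s x t y z ⟩
      s * ⟨ x , z ⟩ + t * ⟨ y , z ⟩
          ≈⟨ +-cong (*-congˡ (linearʳ s x t y x)) (*-congˡ (linearʳ s x t y y)) ⟩
      s * (s * ⟨ x , x ⟩ + t * ⟨ x , y ⟩) +
      t * (s * ⟨ y , x ⟩ + t * ⟨ y , y ⟩)      ≈⟨ +-congˡ (*-congˡ (+-congʳ (*-congˡ (comm y x)))) ⟩
      s * (s * ⟨ x , x ⟩ + t * ⟨ x , y ⟩) +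
      t * (s * ⟨ x , y ⟩ + t * ⟨ y , y ⟩)
          ≈⟨ solve 5 (λ s t a b c →
               s :* (s :* a :+ t :* b) :+ t :* (s :* b :+ t :* c) :=
               s :* s :* a :+ (s :* t :+ s :* t) :* b :+ t :* t :* c)
               refl s t ⟨ x , x ⟩ ⟨ x , y ⟩ ⟨ y , y ⟩ ⟩
      s * s * ⟨ x , x ⟩ + (s * t + s * t) * ⟨ x , y ⟩ + t * t * ⟨ y , y ⟩ ∎
      where z = lincomb s x t y

    -- The norm of -⟨x,y⟩x + ⟨x,x⟩y equals ⟨x,x⟩ times the difference of the two sides, so no
    -- division occurs until the positive factor ⟨x,x⟩ is cancelled.
    cauchy-schwarz-positive : ∀ x y → 0# < ⟨ x , x ⟩ → ⟨ x , y ⟩ * ⟨ x , y ⟩ ≤ ⟨ x , x ⟩ * ⟨ y , y ⟩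
    cauchy-schwarz-positive x y 0<xx = 0≤y-x⇒x≤y (*-nonNegative⁻¹ 0<xx
      (≤-respʳ-≈ (trans (norm-lincomb (- ⟨ x , y ⟩) x ⟨ x , x ⟩ y)
        (solve 3 (λ a b c → :- b :* :- b :* a :+ (:- b :* a :+ :- b :* a) :* b :+ a :* a :* c :=
            a :* (a :* c :- b :* b))
          refl ⟨ x , x ⟩ ⟨ x , y ⟩ ⟨ y , y ⟩))
        (nonNegative (lincomb (- ⟨ x , y ⟩) x ⟨ x , x ⟩ y))))

    cauchy-schwarz : ∀ x y → ⟨ x , y ⟩ * ⟨ x , y ⟩ ≤ ⟨ x , x ⟩ * ⟨ y , y ⟩
    cauchy-schwarz x y with ≈0-or->0 (nonNegative x) | ≈0-or->0 (nonNegative y)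
    ... | inj₂ 0<xx | _         = cauchy-schwarz-positive x y 0<xx
    ... | inj₁ xx≈0 | inj₂ 0<yy = begin
      ⟨ x , y ⟩ * ⟨ x , y ⟩   ≈⟨ *-cong (comm x y) (comm x y) ⟩
      ⟨ y , x ⟩ * ⟨ y , x ⟩   ≤⟨ cauchy-schwarz-positive y x 0<yy ⟩
      ⟨ y , y ⟩ * ⟨ x , x ⟩   ≈⟨ *-comm _ _ ⟩
      ⟨ x , x ⟩ * ⟨ y , y ⟩   ∎
    -- With both vectors null, -bx + y has norm -2b², which nonnegativity forces to be zero.
    ... | inj₁ xx≈0 | inj₁ yy≈0 = begin
      b * b                   ≤⟨ ≤-by (+-nonNegative (nonNegative z) (square-nonNegative b)) (begin-equality
        ⟨ z , z ⟩ + b * b       ≈⟨ +-congʳ (norm-lincomb (- b) x 1# y) ⟩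
        _ + b * b
            ≈⟨ +-congʳ (+-cong (+-congʳ (trans (*-congˡ xx≈0) (zeroʳ _))) (trans (*-congˡ yy≈0) (zeroʳ _))) ⟩
        0# + (- b * 1# + - b * 1#) * b + 0# + b * b
                                ≈⟨ solve 1 (λ b →
                                     con (+ 0) :+ (:- b :* con (+ 1) :+ :- b :* con (+ 1)) :* b :+
                                         con (+ 0) :+ b :* b :=
                                     con (+ 0) :- b :* b) refl b ⟩
        0# - b * b              ∎) ⟩
      0#                      ≈⟨ zeroˡ _ ⟨
      0# * ⟨ y , y ⟩          ≈⟨ *-congʳ xx≈0 ⟨
      ⟨ x , x ⟩ * ⟨ y , y ⟩   ∎
      where
      b = ⟨ x , y ⟩
      z = lincomb (- b) x 1# y

    null⇒orthogonal : ∀ {x} → ⟨ x , x ⟩ ≈ 0# → ∀ y → ⟨ x , y ⟩ ≈ 0#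
    null⇒orthogonal {x} xx≈0 y = x*x≤0⇒x≈0 (≤-respʳ-≈ (trans (*-congʳ xx≈0) (zeroˡ _)) (cauchy-schwarz x y))

    -- The parallelogram law: the norm of sx - y is exactly the slack.
    norm-lincomb-≤ : ∀ s x y → ⟨ lincomb s x 1# y , lincomb s x 1# y ⟩ ≤
                     (1# + 1#) * (s * s * ⟨ x , x ⟩ + ⟨ y , y ⟩)
    norm-lincomb-≤ s x y = ≤-by (nonNegative (lincomb s x (- 1#) y)) (begin-equality
      ⟨ lincomb s x (- 1#) y , lincomb s x (- 1#) y ⟩   ≈⟨ norm-lincomb s x (- 1#) y ⟩
      _     ≈⟨ solve 4 (λ s a b c →
                 s :* s :* a :+ (s :* :- con (+ 1) :+ s :* :- con (+ 1)) :* b :+ :- con (+ 1) :* :-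
                     con (+ 1) :* c :=
                 (con (+ 1) :+ con (+ 1)) :* (s :* s :* a :+ c) :-
                 (s :* s :* a :+ (s :* con (+ 1) :+ s :* con (+ 1)) :* b :+ con (+ 1) :* con (+ 1) :* c))
                 refl s ⟨ x , x ⟩ ⟨ x , y ⟩ ⟨ y , y ⟩ ⟩
      _     ≈⟨ +-congˡ (-‿cong (norm-lincomb s x 1# y)) ⟨
      _     ∎)

  open SemiInnerProduct using () renaming (⟨_,_⟩ to _⟨_,_⟩) public

  pullback : ∀ {m n} → SemiInnerProduct n → LinearMap m n → SemiInnerProduct m
  pullback F L = record
    { ⟨_,_⟩       = λ x y → ⟨ map x , map y ⟩
    ; cong        = λ x≋x′ y≋y′ → F.cong (L.cong x≋x′) (L.cong y≋y′)
    ; comm        = λ x y → F.comm (map x) (map y)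
    ; linearˡ     = λ s x t y z → trans (F.cong (L.linear s x t y) (λ _ → refl)) (F.linearˡ s _ t _ _)
    ; nonNegative = λ x → F.nonNegative (map x)
    }
    where
    module F = SemiInnerProduct F
    module L = LinearMap L
    open F using (⟨_,_⟩)
    open L using (map)

  dotProduct : ∀ n → SemiInnerProduct n
  dotProduct n = record
    { ⟨_,_⟩       = _∙_
    ; cong        = ∙-cong
    ; comm        = ∙-comm
    ; linearˡ     = ∙-linearˡ
    ; nonNegative = λ x → sum-nonNegative (λ i → square-nonNegative (x i))
    }

  matrixForm : ∀ {n} (A : Matrix n n) → IsSymmetric A → IsPSD A → SemiInnerProduct n
  matrixForm A A-sym A-psd = record
    { ⟨_,_⟩       = λ x y → x ∙ (A ⊡ y)
    ; cong        = λ x≋x′ y≋y′ → ∙-cong x≋x′ (⊡-cong A y≋y′)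
    ; comm        = λ x y → begin-equality
        x ∙ (A ⊡ y)     ≈⟨ ∙-⊡-adjoint A x y ⟩
        (A ᵀ ⊡ x) ∙ y   ≈⟨ ∙-cong (λ i → ∙-cong (λ j → A-sym j i) (λ _ → refl)) (λ _ → refl) ⟩
        (A ⊡ x) ∙ y     ≈⟨ ∙-comm (A ⊡ x) y ⟩
        y ∙ (A ⊡ x)     ∎
    ; linearˡ     = λ s x t y z → ∙-linearˡ s x t y (A ⊡ z)
    ; nonNegative = A-psd
    }

  scaledDifference : ∀ {n} μ (F G : SemiInnerProduct n) → (∀ x → G ⟨ x , x ⟩ ≤ μ * F ⟨ x , x ⟩) →
      SemiInnerProduct n
  scaledDifference μ F G G≤μF = record
    { ⟨_,_⟩       = λ x y → μ * F ⟨ x , y ⟩ - G ⟨ x , y ⟩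
    ; cong        = λ x≋x′ y≋y′ → +-cong (*-congˡ (F.cong x≋x′ y≋y′)) (-‿cong (G.cong x≋x′ y≋y′))
    ; comm        = λ x y → +-cong (*-congˡ (F.comm x y)) (-‿cong (G.comm x y))
    ; linearˡ     = λ s x t y z → trans (+-cong (*-congˡ (F.linearˡ s x t y z)) (-‿cong (G.linearˡ s x t y z)))
        (solve 7 (λ μ s t a b c d → μ :* (s :* a :+ t :* b) :- (s :* c :+ t :* d) :=
                                    s :* (μ :* a :- c) :+ t :* (μ :* b :- d)) refl μ s t _ _ _ _)
    ; nonNegative = λ x → x≤y⇒0≤y-x (G≤μF x)
    }
    where
    module F = SemiInnerProduct F
    module G = SemiInnerProduct G

  -- The induction eliminates the first coordinate by completing the square with
  -- respect to F (a Schur complement).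
  null-or-bounded : ∀ {n} (F G : SemiInnerProduct n) →
    (∃ λ x → F ⟨ x , x ⟩ ≈ 0# × 0# < G ⟨ x , x ⟩) ⊎
    (∃ λ K → 0# ≤ K × (∀ x → G ⟨ x , x ⟩ ≤ K * F ⟨ x , x ⟩))
  null-or-bounded {zero} F G = inj₂ (0# , ≤-refl , λ x → begin
      G ⟨ x , x ⟩               ≈⟨ G.cong {y = x} {y′ = x} (λ ()) (λ ()) ⟩
      G ⟨ lincomb 0# x 0# x , x ⟩   ≈⟨ G.linearˡ 0# x 0# x x ⟩
      0# * G ⟨ x , x ⟩ + 0# * G ⟨ x , x ⟩
          ≈⟨ solve 2 (λ g f → con (+ 0) :* g :+ con (+ 0) :* g := con (+ 0) :* f) refl (G ⟨ x , x ⟩)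
              (F ⟨ x , x ⟩) ⟩
      0# * F ⟨ x , x ⟩          ∎)
    where module G = SemiInnerProduct G
  null-or-bounded {suc n} F G = step (null-or-bounded (pullback F L) (pullback G L))
    where
    module F = SemiInnerProduct F
    module G = SemiInnerProduct G

    e : Vector Carrier (suc n)
    e = 1# ∷ᶠ λ _ → 0#

    α = F ⟨ e , e ⟩

    β : Vector Carrier n → Carrier
    β x = F ⟨ 0# ∷ᶠ x , e ⟩ * α ⁻¹

    β-linear : ∀ s x t y → β (lincomb s x t y) ≈ s * β x + t * β y
    β-linear s x t y = trans (*-congʳ (trans (F.cong eq (λ _ → refl)) (F.linearˡ s (0# ∷ᶠ x) t (0# ∷ᶠ y) e)))
      (solve 5 (λ s t a b c → (s :* a :+ t :* b) :* c := s :* (a :* c) :+ t :* (b :* c)) refl s t _ _ _)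
      where
      eq : (0# ∷ᶠ lincomb s x t y) ≋ lincomb s (0# ∷ᶠ x) t (0# ∷ᶠ y)
      eq zero    = solve 2 (λ s t → con (+ 0) := s :* con (+ 0) :+ t :* con (+ 0)) refl s t
      eq (suc i) = refl

    -- Sends x to (0, x) minus its F-projection onto `e`. Together with `e` its image spans the
    -- whole space, so the induction hypothesis is applied to the two forms pulled back along it.
    L : LinearMap n (suc n)
    L = record
      { map    = λ x → - β x ∷ᶠ x
      ; cong   = λ { x≋y zero    → -‿cong (*-congʳ (F.cong (λ { zero → refl ; (suc i) → x≋y i }) (λ _ → refl)))
                   ; x≋y (suc i) → x≋y i }
      ; linear = λ { s x t y zero    → trans (-‿cong (β-linear s x t y))
                                         (solve 4 (λ s t a b → :- (s :* a :+ t :* b) :=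
                                             s :* :- a :+ t :* :- b) refl s t _ _)
                   ; s x t y (suc i) → refl }
      }

    open LinearMap L using (map)

    Le-orthogonal : ∀ x → F ⟨ e , map x ⟩ ≈ 0#
    Le-orthogonal x = begin-equality
      F ⟨ e , map x ⟩                                   ≈⟨ F.comm e (map x) ⟩
      F ⟨ map x , e ⟩                                   ≈⟨ F.cong eq (λ _ → refl) ⟩
      F ⟨ lincomb (- β x) e 1# (0# ∷ᶠ x) , e ⟩           ≈⟨ F.linearˡ (- β x) e 1# (0# ∷ᶠ x) e ⟩
      - (b * α ⁻¹) * α + 1# * b
          ≈⟨ solve 3 (λ b i α → :- (b :* i) :* α :+ con (+ 1) :* b :=
                b :- α :* (i :* b)) refl b (α ⁻¹) α ⟩
      b - α * (α ⁻¹ * b)                                ≈⟨ +-congˡ (-‿cong cancel) ⟩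
      b - b                                             ≈⟨ -‿inverseʳ b ⟩
      0#                                                ∎
      where
      b = F ⟨ 0# ∷ᶠ x , e ⟩
      eq : map x ≋ lincomb (- β x) e 1# (0# ∷ᶠ x)
      eq zero    = solve 1 (λ b → b := b :* con (+ 1) :+ con (+ 1) :* con (+ 0)) refl (- β x)
      eq (suc i) = solve 2 (λ b x → x := b :* con (+ 0) :+ con (+ 1) :* x) refl (- β x) (x i)
      cancel : α * (α ⁻¹ * b) ≈ b
      -- For α = 0 the value of α⁻¹ is unspecified, but `e` is then F-null and hence F-orthogonal to
      -- everything, so b = 0 and the identity survives.
      cancel with α ≈? 0#
      ... | no  α≉0 = x*[x⁻¹*y]≈y α≉0
      ... | yes α≈0 = trans (*-congʳ α≈0) (trans (zeroˡ _) (sym (trans (F.comm _ _) (F.null⇒orthogonal α≈0 _))))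

    coordinate : Vector Carrier (suc n) → Carrier
    coordinate x = head x + β (tail x)

    decompose : ∀ x → x ≋ lincomb (coordinate x) e 1# (map (tail x))
    decompose x zero    = solve 2 (λ x b → x := (x :+ b) :* con (+ 1) :+ con (+ 1) :* :- b) refl (head x)
        (β (tail x))
    decompose x (suc i) = solve 2 (λ c x → x := c :* con (+ 0) :+ con (+ 1) :* x) refl (coordinate x)
        (x (suc i))

    F-decompose : ∀ x → F ⟨ x , x ⟩ ≈ coordinate x * coordinate x * α + F ⟨ map (tail x) , map (tail x) ⟩
    F-decompose x = begin-equality
      F ⟨ x , x ⟩                                  ≈⟨ F.cong (decompose x) (decompose x) ⟩
      _                                            ≈⟨ F.norm-lincomb c e 1# y ⟩
      _
          ≈⟨ +-congʳ (+-congˡ (trans (*-congˡ (Le-orthogonal (tail x))) (zeroʳ _))) ⟩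
      c * c * α + 0# + 1# * 1# * F ⟨ y , y ⟩
          ≈⟨ solve 3 (λ c α f → c :* c :* α :+ con (+ 0) :+ con (+ 1) :* con (+ 1) :* f
               := c :* c :* α :+ f) refl c α (F ⟨ y , y ⟩) ⟩
      c * c * α + F ⟨ y , y ⟩                      ∎
      where
      c = coordinate x
      y = map (tail x)

    -- The decomposition is orthogonal for F but in general not for G. The cross term of G is
    -- absorbed by a factor 2, which is harmless since some finite constant is all that is sought.
    G-decompose : ∀ x →
        G ⟨ x , x ⟩ ≤ (1# + 1#) * (coordinate x * coordinate x * G ⟨ e , e ⟩ + G ⟨ map (tail x) ,
        map (tail x) ⟩)
    G-decompose x = ≤-respˡ-≈ (sym (G.cong (decompose x) (decompose x)))
      (G.norm-lincomb-≤ (coordinate x) e (map (tail x)))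

    bounded : ∀ K K₀ → 0# ≤ K → 0# ≤ K₀ → G ⟨ e , e ⟩ ≤ K₀ * α →
              (∀ x → G ⟨ map x , map x ⟩ ≤ K * F ⟨ map x , map x ⟩) →
              ∀ x → G ⟨ x , x ⟩ ≤ (1# + 1#) * (K + K₀) * F ⟨ x , x ⟩
    bounded K K₀ 0≤K 0≤K₀ Gee≤ GL≤ x = begin
      G ⟨ x , x ⟩                                          ≤⟨ G-decompose x ⟩
      (1# + 1#) * (c * c * G ⟨ e , e ⟩ + G ⟨ y , y ⟩)
          ≤⟨ *-monoˡ-≤ 0≤2 (+-mono-≤ (*-monoˡ-≤ (square-nonNegative c) Gee≤) (GL≤ (tail x))) ⟩
      (1# + 1#) * (c * c * (K₀ * α) + K * F ⟨ y , y ⟩)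
          ≤⟨ ≤-by (*-nonNegative 0≤2 (+-nonNegative
               (*-nonNegative 0≤K (*-nonNegative (square-nonNegative c) (F.nonNegative e)))
               (*-nonNegative 0≤K₀ (F.nonNegative y))))
               (solve 5 (λ c k k₀ α f →
                 (con (+ 1) :+ con (+ 1)) :* (k :* (c :* c :* α) :+ k₀ :* f) :=
                 (con (+ 1) :+ con (+ 1)) :* (k :+ k₀) :* (c :* c :* α :+ f) :-
                 (con (+ 1) :+ con (+ 1)) :* (c :* c :* (k₀ :* α) :+ k :* f))
                 refl c K K₀ α (F ⟨ y , y ⟩)) ⟩
      (1# + 1#) * (K + K₀) * (c * c * α + F ⟨ y , y ⟩)     ≈⟨ *-congˡ (F-decompose x) ⟨
      (1# + 1#) * (K + K₀) * F ⟨ x , x ⟩                   ∎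
      where
      c = coordinate x
      y = map (tail x)
      0≤2 = +-nonNegative 0≤1 0≤1

    step : (∃ λ x → F ⟨ map x , map x ⟩ ≈ 0# × 0# < G ⟨ map x , map x ⟩) ⊎
           (∃ λ K → 0# ≤ K × (∀ x → G ⟨ map x , map x ⟩ ≤ K * F ⟨ map x , map x ⟩)) →
           (∃ λ x → F ⟨ x , x ⟩ ≈ 0# × 0# < G ⟨ x , x ⟩) ⊎
           (∃ λ K → 0# ≤ K × (∀ x → G ⟨ x , x ⟩ ≤ K * F ⟨ x , x ⟩))
    step (inj₁ (x , Fxx≈0 , 0<Gxx)) = inj₁ (map x , Fxx≈0 , 0<Gxx)
    step (inj₂ (K , 0≤K , GL≤)) with ≈0-or->0 (F.nonNegative e) | ≈0-or->0 (G.nonNegative e)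
    -- The constant K₀ compares G with F on `e`. It cannot exist here, where `e` itself is the null
    -- witness; it is 0 when `e` is null for both forms, and G⟨e,e⟩/α when α > 0.
    ... | inj₁ α≈0 | inj₂ 0<Gee = inj₁ (e , α≈0 , 0<Gee)
    ... | inj₁ α≈0 | inj₁ Gee≈0 = inj₂ (_ , *-nonNegative (+-nonNegative 0≤1 0≤1) (+-nonNegative 0≤K ≤-refl) ,
            bounded K 0# 0≤K ≤-refl (≤-reflexive (trans Gee≈0 (sym (zeroˡ α)))) GL≤)
    ... | inj₂ 0<α | _ = inj₂ (_ , *-nonNegative (+-nonNegative 0≤1 0≤1) (+-nonNegative 0≤K 0≤K₀) ,
            bounded K (α ⁻¹ * G ⟨ e , e ⟩) 0≤K 0≤K₀
                (≤-reflexive (sym (trans (*-comm _ _) (x*[x⁻¹*y]≈y (>⇒≉0 0<α))))) GL≤)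
      where 0≤K₀ = *-nonNegative (⁻¹-nonNegative 0<α) (G.nonNegative e)

-- Rayleigh quotients, coordinate vectors and normalization.

module Maximization {a ℓ₁ ℓ₂} (ℝ : CompleteOrderedField a ℓ₁ ℓ₂) where
  open OrderedField ℝ
  open LinearAlgebra ℝ
  open SemiInnerProducts ℝ

  /-*-cancel : ∀ x {y} → ¬ (y ≈ 0#) → x / y * y ≈ x
  /-*-cancel x {y} y≉0 = trans (*-assoc _ _ _) (trans (*-congˡ (*-inverseˡ y y≉0)) (*-identityʳ x))

  /-≤⇒≤-* : ∀ {x y z} → 0# < y → x / y ≤ z → x ≤ z * y
  /-≤⇒≤-* {x} 0<y x/y≤z = ≤-respˡ-≈ (/-*-cancel x (>⇒≉0 0<y)) (*-monoʳ-≤ (<⇒≤ 0<y) x/y≤z)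

  ≤-*⇒/-≤ : ∀ {x y z} → 0# < y → x ≤ z * y → x / y ≤ z
  ≤-*⇒/-≤ {x} {y} {z} 0<y x≤zy = *-cancelˡ-≤ 0<y (begin
    y * (x / y)   ≈⟨ *-comm _ _ ⟩
    x / y * y     ≈⟨ /-*-cancel x (>⇒≉0 0<y) ⟩
    x             ≤⟨ x≤zy ⟩
    z * y         ≈⟨ *-comm z y ⟩
    y * z         ∎)

  *-≤⇒≤-/ : ∀ {x y z} → 0# < y → z * y ≤ x → z ≤ x / y
  *-≤⇒≤-/ {x} {y} {z} 0<y zy≤x = *-cancelˡ-≤ 0<y (begin
    y * z         ≈⟨ *-comm y z ⟩
    z * y         ≤⟨ zy≤x ⟩
    x             ≈⟨ /-*-cancel x (>⇒≉0 0<y) ⟨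
    x / y * y     ≈⟨ *-comm _ _ ⟩
    y * (x / y)   ∎)

  /-cong : ∀ {x x′ y y′} → x ≈ x′ → y ≈ y′ → x / y ≈ x′ / y′
  /-cong x≈x′ y≈y′ = *-cong x≈x′ (⁻¹-cong y≈y′)

  module _ {n} (F G : SemiInnerProduct n) where
    rayleigh : Vector Carrier n → Carrier
    rayleigh x = G ⟨ x , x ⟩ / F ⟨ x , x ⟩

    -- If the supremum μ of the Rayleigh quotients were not attained, then μF - G
    -- would dominate a positive multiple of F, and μ could be lowered.
    rayleigh-attains-maximum :
      (∀ x → F ⟨ x , x ⟩ ≈ 0# → G ⟨ x , x ⟩ ≈ 0#) → (∃ λ x → 0# < F ⟨ x , x ⟩) →
      ∃ λ x → 0# < F ⟨ x , x ⟩ × (∀ y → 0# < F ⟨ y , y ⟩ → rayleigh y ≤ rayleigh x)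
    rayleigh-attains-maximum F-null⇒G-null (x₀ , 0<Fx₀) = attained (null-or-bounded M F)
      where
      P : Carrier → Set (a ⊔ ℓ₁ ⊔ ℓ₂)
      P r = ∃ λ x → 0# < F ⟨ x , x ⟩ × r ≈ rayleigh x

      bounded : (∃ λ x → F ⟨ x , x ⟩ ≈ 0# × 0# < G ⟨ x , x ⟩) ⊎
                (∃ λ K → 0# ≤ K × (∀ x → G ⟨ x , x ⟩ ≤ K * F ⟨ x , x ⟩)) →
                ∃ (IsUpperBound P)
      bounded (inj₁ (x , Fx≈0 , 0<Gx)) = contradiction (F-null⇒G-null x Fx≈0) (>⇒≉0 0<Gx)
      bounded (inj₂ (K , _ , G≤KF)) = K , λ { r (x , 0<Fx , r≈) → ≤-respˡ-≈ (sym r≈) (≤-*⇒/-≤ 0<Fx (G≤KF x)) }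

      sup = supremum P (rayleigh x₀ , x₀ , 0<Fx₀ , refl) (bounded (null-or-bounded F G))
      μ = proj₁ sup
      least = proj₂ (proj₂ sup)

      rayleigh≤μ : ∀ x → 0# < F ⟨ x , x ⟩ → rayleigh x ≤ μ
      rayleigh≤μ x 0<Fx = proj₁ (proj₂ sup) (rayleigh x) (x , 0<Fx , refl)

      G≤μF : ∀ x → G ⟨ x , x ⟩ ≤ μ * F ⟨ x , x ⟩
      G≤μF x with ≈0-or->0 (SemiInnerProduct.nonNegative F x)
      ... | inj₁ Fx≈0 = ≤-reflexive (trans (F-null⇒G-null x Fx≈0) (sym (trans (*-congˡ Fx≈0) (zeroʳ μ))))
      ... | inj₂ 0<Fx = /-≤⇒≤-* 0<Fx (rayleigh≤μ x 0<Fx)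

      M = scaledDifference μ F G G≤μF

      attained : (∃ λ x → M ⟨ x , x ⟩ ≈ 0# × 0# < F ⟨ x , x ⟩) ⊎
                 (∃ λ K → 0# ≤ K × (∀ x → F ⟨ x , x ⟩ ≤ K * M ⟨ x , x ⟩)) →
                 ∃ λ x → 0# < F ⟨ x , x ⟩ × (∀ y → 0# < F ⟨ y , y ⟩ → rayleigh y ≤ rayleigh x)
      -- An M-null vector satisfies G = μF, so its quotient is the supremum itself. The dichotomy is
      -- applied here to M and F, whereas for boundedness it was applied to F and G.
      attained (inj₁ (x , Mx≈0 , 0<Fx)) = x , 0<Fx , λ y 0<Fy → ≤-trans (rayleigh≤μ y 0<Fy)
        (*-≤⇒≤-/ 0<Fx (0≤y-x⇒x≤y (≤-reflexive (begin-equality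
          0#                                  ≈⟨ solve 0 (con (+ 0) := :- con (+ 0)) refl ⟩
          - 0#                                ≈⟨ -‿cong Mx≈0 ⟨
          - (μ * F ⟨ x , x ⟩ - G ⟨ x , x ⟩)   ≈⟨ solve 2 (λ x y → :- (x :- y) := y :- x) refl _ _ ⟩
          G ⟨ x , x ⟩ - μ * F ⟨ x , x ⟩       ∎))))
      attained (inj₂ (K , 0≤K , F≤KM)) with ≈0-or->0 0≤K
      ... | inj₁ K≈0 = contradiction (≤-respʳ-≈ (trans (*-congʳ K≈0) (zeroˡ _)) (F≤KM x₀)) (<⇒≱ 0<Fx₀)
      ... | inj₂ 0<K = contradiction (least (μ - K ⁻¹) lowered) (<⇒≱ (x-h<x μ (⁻¹-positive 0<K)))
        where
        lowered : IsUpperBound P (μ - K ⁻¹)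
        lowered r (x , 0<Fx , r≈) = ≤-respˡ-≈ (sym r≈) (≤-*⇒/-≤ 0<Fx (*-cancelˡ-≤ 0<K
          (≤-by (x≤y⇒0≤y-x (F≤KM x)) (begin-equality
            K * (μ * f - g) - f                  ≈⟨ +-congˡ (-‿cong (*-identityˡ f)) ⟨
            K * (μ * f - g) - 1# * f             ≈⟨ +-congˡ (-‿cong (*-congʳ (*-inverseʳ K (>⇒≉0 0<K)))) ⟨
            K * (μ * f - g) - K * K ⁻¹ * f
                ≈⟨ solve 5 (λ K i μ f g → K :* (μ :* f :- g) :- K :* i :* f :=
                     K :* ((μ :- i) :* f) :- K :* g) refl K (K ⁻¹) μ f g ⟩
            K * ((μ - K ⁻¹) * f) - K * g         ∎))))
          where
          f = F ⟨ x , x ⟩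
          g = G ⟨ x , x ⟩

  sum-zero : ∀ {n} {x : Vector Carrier n} → (∀ i → x i ≈ 0#) → sum x ≈ 0#
  sum-zero {n} x≈0 = trans (sum-cong-≋ x≈0) (sum-replicate-zero n)

  unit : ∀ {n} → Fin n → Vector Carrier n
  unit i j = if does (i ≟ j) then 1# else 0#

  unit-∙ : ∀ {n} (i : Fin n) x → unit i ∙ x ≈ x i
  unit-∙ zero    x = trans (+-cong (*-identityˡ _) (sum-zero (λ j → zeroˡ (x (suc j))))) (+-identityʳ _)
  unit-∙ (suc i) x = trans (+-cong (zeroˡ _) (unit-∙ i (tail x))) (+-identityˡ _)

  unit-self : ∀ {n} (i : Fin n) → unit i i ≈ 1#
  unit-self zero    = refl
  unit-self (suc i) = unit-self i

  unit-isUnit : ∀ {n} (i : Fin n) → IsUnit (unit i)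
  unit-isUnit i = 0≤1 , trans (*-identityˡ 1#) (sym (trans (unit-∙ i (unit i)) (unit-self i)))

  unit-entry : ∀ {m n} (M : Matrix m n) i j → unit i ∙ (M ⊡ unit j) ≈ M i j
  unit-entry M i j = trans (unit-∙ i _) (trans (∙-comm (M i) (unit j)) (unit-∙ j (M i)))

  norm-scale : ∀ {n} (F : SemiInnerProduct n) s {x y} → (∀ i → y i ≈ x i * s) →
      F ⟨ y , y ⟩ ≈ s * s * F ⟨ x , x ⟩
  norm-scale F s {x} {y} y≈sx = begin-equality
    F ⟨ y , y ⟩                                      ≈⟨ F.cong eq eq ⟩
    _                                                ≈⟨ F.norm-lincomb s x 0# x ⟩
    _
        ≈⟨ solve 2 (λ s f → s :* s :* f :+ (s :* con (+ 0) :+ s :* con (+ 0)) :* f :+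
             con (+ 0) :* con (+ 0) :* f := s :* s :* f) refl s (F ⟨ x , x ⟩) ⟩
    s * s * F ⟨ x , x ⟩                              ∎
    where
    module F = SemiInnerProduct F
    eq : y ≋ lincomb s x 0# x
    eq i = trans (y≈sx i) (solve 2 (λ x s → x :* s := s :* x :+ con (+ 0) :* x) refl (x i) s)

  module _ {n} {w u : Vector Carrier n} {r : Carrier} (0<ww : 0# < w ∙ w) (r-norm : Is‖ w ‖₂ r)
      (u≈w/r : ∀ i → u i ≈ w i / r) where
    private
      rr≈ww = proj₂ r-norm

      r≉0 : ¬ (r ≈ 0#)
      r≉0 r≈0 = >⇒≉0 0<ww (trans (sym rr≈ww) (trans (*-congʳ r≈0) (zeroˡ r)))

    -- Kept general in F because it is used twice: the dot product shows that the output has unit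
    -- length, and the A-form expresses its value uᵀAu through w.
    normalize-form : (F : SemiInnerProduct n) → (w ∙ w) * F ⟨ u , u ⟩ ≈ F ⟨ w , w ⟩
    normalize-form F = begin-equality
      (w ∙ w) * F ⟨ u , u ⟩                        ≈⟨ *-cong (sym rr≈ww) (norm-scale F (r ⁻¹) u≈w/r) ⟩
      r * r * (r ⁻¹ * r ⁻¹ * f)
          ≈⟨ solve 3 (λ r i f → r :* r :* (i :* i :* f) := (r :* i) :* ((r :* i) :* f)) refl r (r ⁻¹) f ⟩
      r * r ⁻¹ * (r * r ⁻¹ * f)
          ≈⟨ trans (*-congʳ inv) (trans (*-identityˡ _) (trans (*-congʳ inv) (*-identityˡ f))) ⟩
      f                                            ∎
      where
      f = F ⟨ w , w ⟩
      inv = *-inverseʳ r r≉0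

    normalize-isUnit : IsUnit u
    normalize-isUnit = 0≤1 , ≤-antisym
      (*-cancelˡ-≤ 0<ww (≤-reflexive (trans (trans (*-congˡ (*-identityˡ 1#)) (*-identityʳ _)) (sym eq))))
      (*-cancelˡ-≤ 0<ww (≤-reflexive (sym (trans (trans (*-congˡ (*-identityˡ 1#)) (*-identityʳ _)) (sym eq)))))
      where eq = normalize-form (dotProduct n)

-- Existence and value of the outputs of Algorithm E.

module AlgorithmProperties {a ℓ₁ ℓ₂} (ℝ : CompleteOrderedField a ℓ₁ ℓ₂) where
  open OrderedField ℝ
  open LinearAlgebra ℝ
  open SemiInnerProducts ℝ
  open Maximization ℝ
  open AlgorithmE ℝ

  module _ {n} (A : Matrix n n) (A-sym : IsSymmetric A) (A-psd : IsPSD A) where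
    Aform : SemiInnerProduct n
    Aform = matrixForm A A-sym A-psd

    ⊡-self-adjoint : ∀ x y → x ∙ (A ⊡ y) ≈ (A ⊡ x) ∙ y
    ⊡-self-adjoint x y = trans (SemiInnerProduct.comm Aform x y) (∙-comm y (A ⊡ x))

    module _ (T : Subset n) where
      private
        S₀ = S A T
        AS₀ = AS A T

      -- The forms of `SᵀAS` and `SᵀA²S`. Presenting them as pullbacks along S and AS makes symmetry
      -- and semidefiniteness immediate.
      F G : SemiInnerProduct ∣ T ∣
      F = pullback Aform (matrixMap S₀)
      G = pullback (dotProduct n) (matrixMap AS₀)

      AS-⊡ : ∀ x → AS₀ ⊡ x ≋ A ⊡ (S₀ ⊡ x)
      AS-⊡ = ⊠-⊡-assoc A S₀

      SᵀAS-form : ∀ x y → x ∙ (SᵀAS A T ⊡ y) ≈ F ⟨ x , y ⟩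
      SᵀAS-form x y = begin-equality
        x ∙ (SᵀAS A T ⊡ y)             ≈⟨ ∙-cong (λ _ → refl) (⊠-⊡-assoc (S₀ ᵀ) AS₀ y) ⟩
        x ∙ (S₀ ᵀ ⊡ (AS₀ ⊡ y))         ≈⟨ ∙-⊡-adjoint (S₀ ᵀ) x (AS₀ ⊡ y) ⟩
        (S₀ ⊡ x) ∙ (AS₀ ⊡ y)           ≈⟨ ∙-cong (λ _ → refl) (AS-⊡ y) ⟩
        (S₀ ⊡ x) ∙ (A ⊡ (S₀ ⊡ y))      ∎

      SᵀA²S-form : ∀ x y → x ∙ (SᵀA²S A T ⊡ y) ≈ G ⟨ x , y ⟩
      SᵀA²S-form x y = trans (∙-cong (λ _ → refl) (⊠-⊡-assoc (AS₀ ᵀ) AS₀ y)) (∙-⊡-adjoint (AS₀ ᵀ) x (AS₀ ⊡ y))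

      ratio≈rayleigh : ∀ x → ratio A T x ≈ rayleigh F G x
      ratio≈rayleigh x = /-cong (SᵀA²S-form x x) (SᵀAS-form x x)

      -- With z = Sx, ‖Az‖² is the A-form of z against Az, and an A-null z is A-orthogonal to
      -- everything. This keeps the ratio bounded and its maximum attained even when `SᵀAS` is
      -- singular.
      F-null⇒G-null : ∀ x → F ⟨ x , x ⟩ ≈ 0# → G ⟨ x , x ⟩ ≈ 0#
      F-null⇒G-null x Fx≈0 = begin-equality
        (AS₀ ⊡ x) ∙ (AS₀ ⊡ x)          ≈⟨ ∙-cong (AS-⊡ x) (AS-⊡ x) ⟩
        (A ⊡ z) ∙ (A ⊡ z)              ≈⟨ ⊡-self-adjoint z (A ⊡ z) ⟨
        z ∙ (A ⊡ (A ⊡ z))              ≈⟨ SemiInnerProduct.null⇒orthogonal Aform Fx≈0 (A ⊡ z) ⟩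
        0#                             ∎
        where z = S₀ ⊡ x

      admissible⇒ : ∀ {x} → Admissible A T x → 0# < F ⟨ x , x ⟩
      admissible⇒ {x} = <-respʳ-≈ (SᵀAS-form x x)

      ⇒admissible : ∀ {x} → 0# < F ⟨ x , x ⟩ → Admissible A T x
      ⇒admissible {x} = <-respʳ-≈ (sym (SᵀAS-form x x))

      -- Guarantees that the output divides by a nonzero norm: F⟨x,x⟩ is the dot product of ASx with
      -- Sx, which vanishes when ASx has norm zero.
      G-positive : ∀ {x} → 0# < F ⟨ x , x ⟩ → 0# < G ⟨ x , x ⟩
      G-positive {x} 0<Fx with ≈0-or->0 (SemiInnerProduct.nonNegative G x)
      ... | inj₂ 0<Gx = 0<Gx
      ... | inj₁ Gx≈0 = contradiction (begin-equality
        z ∙ (A ⊡ z)        ≈⟨ ∙-cong (λ _ → refl) (AS-⊡ x) ⟨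
        z ∙ (AS₀ ⊡ x)      ≈⟨ ∙-comm z (AS₀ ⊡ x) ⟩
        (AS₀ ⊡ x) ∙ z      ≈⟨ SemiInnerProduct.null⇒orthogonal (dotProduct n) Gx≈0 z ⟩
        0#                 ∎) (>⇒≉0 0<Fx)
        where z = S₀ ⊡ x

      zero⇒F-null : IsZero (SᵀAS A T) → ∀ x → F ⟨ x , x ⟩ ≈ 0#
      zero⇒F-null M≈0 x = trans (sym (SᵀAS-form x x))
        (sum-zero λ i → trans (*-congˡ (sum-zero λ j → trans (*-congʳ (M≈0 i j)) (zeroˡ _))) (zeroʳ _))

      -- A semidefinite form with zero diagonal is zero by Cauchy-Schwarz, so a finite search over
      -- coordinate vectors decides the branch of the algorithm.
      nonZero-or-zero : (∃ λ x → 0# < F ⟨ x , x ⟩) ⊎ IsZero (SᵀAS A T)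
      nonZero-or-zero with any? (λ i → ¬? (F ⟨ unit i , unit i ⟩ ≤? 0#))
      ... | yes (i , ≰0) = inj₁ (unit i , ≰⇒> ≰0)
      ... | no  all≤0    = inj₂ λ i j → trans (sym (unit-entry (SᵀAS A T) i j))
          (trans (SᵀAS-form (unit i) (unit j))
              (SemiInnerProduct.null⇒orthogonal F (null i) (unit j)))
        where
        null : ∀ i → F ⟨ unit i , unit i ⟩ ≈ 0#
        null i with F ⟨ unit i , unit i ⟩ ≤? 0#
        ... | yes ≤0 = ≤-antisym ≤0 (SemiInnerProduct.nonNegative F (unit i))
        ... | no  ≰0 = contradiction (i , ≰0) all≤0

      maximizer⇒returns : ∀ x → 0# < F ⟨ x , x ⟩ →
        (∀ y → 0# < F ⟨ y , y ⟩ → rayleigh F G y ≤ rayleigh F G x) → ∃ (Returns A T)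
      maximizer⇒returns x 0<Fx maximal = _ , normalized (λ M≈0 → >⇒≉0 0<Fx (zero⇒F-null M≈0 x)) x isMaximizer
        (proj₁ root) (proj₂ root) (λ _ → refl)
        where
        root = sqrt (SemiInnerProduct.nonNegative G x)
        isMaximizer : IsMaximizer A T x
        isMaximizer = ⇒admissible 0<Fx , λ y adm → begin
          ratio A T y          ≈⟨ ratio≈rayleigh y ⟩
          rayleigh F G y       ≤⟨ maximal y (admissible⇒ adm) ⟩
          rayleigh F G x       ≈⟨ ratio≈rayleigh x ⟨
          ratio A T x          ∎

      zero⇒returns : .{{_ : NonZero n}} → IsZero (SᵀAS A T) → ∃ (Returns A T)
      zero⇒returns M≈0 = proj₁ (someUnit n) , arbitrary M≈0 (proj₂ (someUnit n))
        where
        someUnit : ∀ n .{{_ : NonZero n}} → ∃ λ (u : Vector Carrier n) → IsUnit u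
        someUnit (suc n) = unit {suc n} zero , unit-isUnit {suc n} zero

      returns-exists : .{{_ : NonZero n}} → ∃ (Returns A T)
      returns-exists = [ nonNull⇒returns , zero⇒returns ]′ nonZero-or-zero
        where
        nonNull⇒returns : (∃ λ x → 0# < F ⟨ x , x ⟩) → ∃ (Returns A T)
        nonNull⇒returns nonNull = maximizer⇒returns (proj₁ best) (proj₁ (proj₂ best)) (proj₂ (proj₂ best))
          where best = rayleigh-attains-maximum F G F-null⇒G-null nonNull

      returns⇒isUnit : ∀ {u} → Returns A T u → IsUnit u
      returns⇒isUnit (arbitrary _ u-unit) = u-unit
      returns⇒isUnit (normalized _ x (adm , _) r r-norm u≈) = normalize-isUnit (G-positive (admissible⇒ adm))
          r-norm u≈

      -- Cauchy–Schwarz in the A-form, applied to Sx and ASx.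
      returns⇒ratio≤value : ∀ {u} → Returns A T u → ∀ y → 0# < F ⟨ y , y ⟩ → rayleigh F G y ≤ quadraticForm A u
      returns⇒ratio≤value (arbitrary M≈0 _) y 0<Fy = contradiction (zero⇒F-null M≈0 y) (>⇒≉0 0<Fy)
      returns⇒ratio≤value {u} (normalized _ x (adm , maximal) r r-norm u≈) y 0<Fy = begin
        rayleigh F G y       ≈⟨ ratio≈rayleigh y ⟨
        ratio A T y          ≤⟨ maximal y (⇒admissible 0<Fy) ⟩
        ratio A T x          ≈⟨ ratio≈rayleigh x ⟩
        rayleigh F G x       ≤⟨ ≤-*⇒/-≤ 0<Fx (*-cancelˡ-≤ 0<Gx (begin
          (w ∙ w) * (w ∙ w)                      ≈⟨ *-cong zw≈ww zw≈ww ⟨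
          Aform ⟨ z , w ⟩ * Aform ⟨ z , w ⟩      ≤⟨ SemiInnerProduct.cauchy-schwarz Aform z w ⟩
          Aform ⟨ z , z ⟩ * Aform ⟨ w , w ⟩      ≈⟨ *-congˡ (normalize-form 0<Gx r-norm u≈ Aform) ⟨
          Aform ⟨ z , z ⟩ * ((w ∙ w) * q)
              ≈⟨ solve 3 (λ a b c → a :* (b :* c) := b :* (c :* a)) refl _ _ _ ⟩
          (w ∙ w) * (q * Aform ⟨ z , z ⟩)        ∎)) ⟩
        q                    ∎
        where
        z = S₀ ⊡ x
        w = AS₀ ⊡ x
        q = quadraticForm A u
        0<Fx = admissible⇒ adm
        0<Gx = G-positive 0<Fx
        zw≈ww : Aform ⟨ z , w ⟩ ≈ w ∙ w
        zw≈ww = trans (⊡-self-adjoint z w) (∙-cong (λ i → sym (AS-⊡ x i)) (λ _ → refl))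

-- Expectations over a random subset and Markov's inequality.

module RandomSubset {a ℓ₁ ℓ₂} (ℝ : CompleteOrderedField a ℓ₁ ℓ₂) (p : CompleteOrderedField.Carrier ℝ) where
  open OrderedField ℝ
  open LinearAlgebra ℝ
  open SemiInnerProducts ℝ
  open Sampling ℝ

  sumSubsets-cong : ∀ {n} {f g : Subset n → Carrier} → (∀ T → f T ≈ g T) → sumSubsets f ≈ sumSubsets g
  sumSubsets-cong {zero}  f≈g = f≈g []
  sumSubsets-cong {suc n} f≈g = +-cong (sumSubsets-cong (λ T → f≈g (inside ∷ T)))
      (sumSubsets-cong (λ T → f≈g (outside ∷ T)))

  sumSubsets-mono-≤ : ∀ {n} {f g : Subset n → Carrier} → (∀ T → f T ≤ g T) → sumSubsets f ≤ sumSubsets g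
  sumSubsets-mono-≤ {zero}  f≤g = f≤g []
  sumSubsets-mono-≤ {suc n} f≤g = +-mono-≤ (sumSubsets-mono-≤ (λ T → f≤g (inside ∷ T)))
      (sumSubsets-mono-≤ (λ T → f≤g (outside ∷ T)))

  sumSubsets-linear : ∀ {n} s (f : Subset n → Carrier) t g →
    sumSubsets (λ T → s * f T + t * g T) ≈ s * sumSubsets f + t * sumSubsets g
  sumSubsets-linear {zero}  s f t g = refl
  sumSubsets-linear {suc n} s f t g = trans
    (+-cong (sumSubsets-linear s (f ∘ (inside ∷_)) t (g ∘ (inside ∷_)))
            (sumSubsets-linear s (f ∘ (outside ∷_)) t (g ∘ (outside ∷_))))
    (solve 6 (λ s t a b c d → (s :* a :+ t :* b) :+ (s :* c :+ t :* d) := s :* (a :+ c) :+ t :* (b :+ d))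
        refl s t
      (sumSubsets (f ∘ (inside ∷_))) (sumSubsets (g ∘ (inside ∷_)))
      (sumSubsets (f ∘ (outside ∷_))) (sumSubsets (g ∘ (outside ∷_))))

  sumSubsets-scale : ∀ {n} s (f : Subset n → Carrier) → sumSubsets (λ T → s * f T) ≈ s * sumSubsets f
  sumSubsets-scale {zero}  s f = refl
  sumSubsets-scale {suc n} s f = trans
    (+-cong (sumSubsets-scale s (f ∘ (inside ∷_))) (sumSubsets-scale s (f ∘ (outside ∷_))))
    (sym (distribˡ s _ _))

  expectation : ∀ {n} → (Subset n → Carrier) → Carrier
  expectation f = sumSubsets (λ T → mass p T * f T)

  expectation-cong : ∀ {n} {f g : Subset n → Carrier} → (∀ T → f T ≈ g T) → expectation f ≈ expectation g
  expectation-cong f≈g = sumSubsets-cong (λ T → *-congˡ (f≈g T))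

  expectation-linear : ∀ {n} s (f : Subset n → Carrier) t g →
    expectation (λ T → s * f T + t * g T) ≈ s * expectation f + t * expectation g
  expectation-linear s f t g = trans
    (sumSubsets-cong λ T → solve 5 (λ m s f t g → m :* (s :* f :+ t :* g) := s :* (m :* f) :+ t :* (m :* g))
      refl (mass p T) s (f T) t (g T))
    (sumSubsets-linear s (λ T → mass p T * f T) t (λ T → mass p T * g T))

  -- Conditioning on the first index. Independence is used in this form, through induction on the
  -- number of indices.
  expectation-suc : ∀ {n} (f : Subset (suc n) → Carrier) →
    expectation f ≈ p * expectation (f ∘ (inside ∷_)) + (1# - p) * expectation (f ∘ (outside ∷_))
  expectation-suc f = +-cong (branch p (f ∘ (inside ∷_))) (branch (1# - p) (f ∘ (outside ∷_)))
    where
    branch : ∀ {n} q (g : Subset n → Carrier) → sumSubsets (λ T → q * mass p T * g T) ≈ q * expectation g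
    branch q g = trans (sumSubsets-cong λ T → *-assoc q (mass p T) (g T))
        (sumSubsets-scale q (λ T → mass p T * g T))

  expectation-const : ∀ n s → expectation {n} (λ _ → s) ≈ s
  expectation-const zero    s = *-identityˡ s
  expectation-const (suc n) s = trans (expectation-suc {n} (λ _ → s)) (trans
    (+-cong (*-congˡ (expectation-const n s)) (*-congˡ (expectation-const n s)))
    (solve 2 (λ p s → p :* s :+ (con (+ 1) :- p) :* s := s) refl p s))

  expectation-affine : ∀ {n} c s (f g : Subset n → Carrier) →
    expectation (λ T → c + s * f T + g T) ≈ c + s * expectation f + expectation g
  expectation-affine {n} c s f g = begin-equality
    expectation (λ T → c + s * f T + g T)
        ≈⟨ expectation-cong (λ T →
              solve 4 (λ c s f g → c :+ s :* f :+ g :=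
                  con (+ 1) :* (con (+ 1) :* c :+ s :* f) :+ con (+ 1) :* g)
                refl c s (f T) (g T)) ⟩
    expectation (λ T → 1# * (1# * c + s * f T) + 1# * g T)
        ≈⟨ expectation-linear 1# (λ T → 1# * c + s * f T) 1# g ⟩
    1# * expectation (λ T → 1# * c + s * f T) + 1# * expectation g
        ≈⟨ +-cong (trans (*-identityˡ _) (expectation-linear 1# (λ _ → c) s f)) (*-identityˡ _) ⟩
    1# * expectation {n} (λ _ → c) + s * expectation f + expectation g
        ≈⟨ +-congʳ (+-congʳ (trans (*-identityˡ _) (expectation-const n c))) ⟩
    c + s * expectation f + expectation g                  ∎

  deviation : ∀ {n} → Subset n → Vector Carrier n
  deviation (inside  ∷ T) zero    = 1# - p
  deviation (outside ∷ T) zero    = - p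
  deviation (_       ∷ T) (suc i) = deviation T i

  expectation-deviation-∙ : ∀ {n} (w : Vector Carrier n) → expectation (λ T → deviation T ∙ w) ≈ 0#
  expectation-deviation-∙ {zero}  w = zeroʳ 1#
  expectation-deviation-∙ {suc n} w = begin-equality
    expectation (λ T → deviation T ∙ w)       ≈⟨ expectation-suc (λ T → deviation T ∙ w) ⟩
    _                                         ≈⟨ +-cong (*-congˡ (branch (1# - p))) (*-congˡ (branch (- p))) ⟩
    p * ((1# - p) * head w) + (1# - p) * (- p * head w)
        ≈⟨ solve 2 (λ p w → p :* ((con (+ 1) :- p) :* w) :+ (con (+ 1) :- p) :* (:- p :* w) := con (+ 0))
            refl p (head w) ⟩
    0#                                        ∎
    where
    branch : ∀ x → expectation (λ T → x * head w + deviation T ∙ tail w) ≈ x * head w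
    branch x = begin-equality
      expectation (λ T → x * head w + deviation T ∙ tail w)
          ≈⟨ expectation-cong (λ T → solve 2 (λ a b → a :+ b := a :+ con (+ 0) :* con (+ 0) :+ b)
              refl (x * head w) (deviation T ∙ tail w)) ⟩
      expectation {n} (λ T → x * head w + 0# * 0# + deviation T ∙ tail w)
          ≈⟨ expectation-affine (x * head w) 0# (λ _ → 0#) (λ T → deviation T ∙ tail w) ⟩
      x * head w + 0# * expectation {n} (λ _ → 0#) + expectation (λ T → deviation T ∙ tail w)
          ≈⟨ +-cong (trans (+-congˡ (zeroˡ _)) (+-identityʳ _)) (expectation-deviation-∙ (tail w)) ⟩
      x * head w + 0#
          ≈⟨ +-identityʳ _ ⟩
      x * head w   ∎

  -- The coordinates of the deviation are independent with mean 0 and variance p(1 - p), so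
  -- off-diagonal terms average out. The induction peels off the first coordinate x: its square
  -- supplies the diagonal entry, and its cross terms are linear in the remaining deviations, which
  -- have mean zero.
  expectation-deviation-form : ∀ {n} (Q : Matrix n n) →
    expectation (λ T → deviation T ∙ (Q ⊡ deviation T)) ≈ p * (1# - p) * sum (λ i → Q i i)
  expectation-deviation-form {zero}  Q = solve 2 (λ p q → con (+ 1) :* con (+ 0) := p :* q :* con (+ 0))
      refl p (1# - p)
  expectation-deviation-form {suc n} Q = begin-equality
    expectation (λ T → deviation T ∙ (Q ⊡ deviation T))
        ≈⟨ expectation-suc (λ T → deviation T ∙ (Q ⊡ deviation T)) ⟩
    p * expectation (split (1# - p)) + (1# - p) * expectation (split (- p))
        ≈⟨ +-cong (*-congˡ (branch (1# - p))) (*-congˡ (branch (- p))) ⟩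
    p * ((1# - p) * (1# - p) * q + p * (1# - p) * s) + (1# - p) * (- p * - p * q + p * (1# - p) * s)
        ≈⟨ solve 3 (λ p q s → p :* ((con (+ 1) :- p) :* (con (+ 1) :- p) :* q :+ p :* (con (+ 1) :- p) :* s) :+
                     (con (+ 1) :- p) :* (:- p :* :- p :* q :+ p :* (con (+ 1) :- p) :* s) :=
                     p :* (con (+ 1) :- p) :* (q :+ s)) refl p q s ⟩
    p * (1# - p) * (q + s)   ∎
    where
    Q′ : Matrix n n
    Q′ i j = Q (suc i) (suc j)
    q = Q zero zero
    s = sum (λ i → Q′ i i)
    -- Row and column are collected separately, since Q is an arbitrary matrix here.
    border : Vector Carrier n
    border i = Q zero (suc i) + Q (suc i) zero

    -- What the quadratic form unfolds to when the first deviation is x, that is 1 - p or -p.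
    split : Carrier → Subset n → Carrier
    split x T = x * (q * x + tail (Q zero) ∙ d) + d ∙ (λ i → Q (suc i) zero * x + (Q′ ⊡ d) i)
      where d = deviation T

    split-expand : ∀ x T → split x T ≈ x * x * q + x * (deviation T ∙ border) + deviation T ∙ (Q′ ⊡ deviation T)
    split-expand x T = begin-equality
      split x T
          ≈⟨ +-cong (*-congˡ (+-congˡ (∙-comm (tail (Q zero)) d))) (trans (sum-cong-≋ λ i → distribˡ (d i) _ _)
               (∑-distrib-+ (λ i → d i * (Q (suc i) zero * x)) (λ i → d i * (Q′ ⊡ d) i))) ⟩
      x * (q * x + d ∙ tail (Q zero)) + (d ∙ (λ i → Q (suc i) zero * x) + h)
          ≈⟨ +-congˡ (+-congʳ (trans (sum-cong-≋ λ i → solve 3 (λ d c x → d :* (c :* x) := x :* (d :* c))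
              refl (d i) (Q (suc i) zero) x)
                                     (sym (*-distribˡ-sum x (λ i → d i * Q (suc i) zero))))) ⟩
      x * (q * x + d ∙ tail (Q zero)) + (x * (d ∙ (λ i → Q (suc i) zero)) + h)
          ≈⟨ solve 5 (λ x q a b h → x :* (q :* x :+ a) :+ (x :* b :+ h) := x :* x :* q :+ x :* (a :+ b) :+ h)
               refl x q (d ∙ tail (Q zero)) (d ∙ (λ i → Q (suc i) zero)) h ⟩
      x * x * q + x * (d ∙ tail (Q zero) + d ∙ (λ i → Q (suc i) zero)) + h
          ≈⟨ +-congʳ (+-congˡ (*-congˡ (trans (sum-cong-≋ λ i → distribˡ (d i) _ _)
               (∑-distrib-+ (λ i → d i * Q zero (suc i)) (λ i → d i * Q (suc i) zero))))) ⟨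
      x * x * q + x * (d ∙ border) + h   ∎
      where
      d = deviation T
      h = d ∙ (Q′ ⊡ d)

    branch : ∀ x → expectation (split x) ≈ x * x * q + p * (1# - p) * s
    branch x = begin-equality
      expectation (split x)   ≈⟨ expectation-cong (split-expand x) ⟩
      _
          ≈⟨ expectation-affine (x * x * q) x (λ T → deviation T ∙ border)
          (λ T → deviation T ∙ (Q′ ⊡ deviation T)) ⟩
      _
          ≈⟨ +-cong (trans (+-congˡ (trans (*-congˡ (expectation-deviation-∙ border)) (zeroʳ x)))
          (+-identityʳ _))
                                        (expectation-deviation-form Q′) ⟩
      x * x * q + p * (1# - p) * s   ∎

  module _ (0≤p : 0# ≤ p) (p≤1 : p ≤ 1#) where
    mass-nonNegative : ∀ {n} (T : Subset n) → 0# ≤ mass p T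
    mass-nonNegative []            = 0≤1
    mass-nonNegative (inside  ∷ T) = *-nonNegative 0≤p (mass-nonNegative T)
    mass-nonNegative (outside ∷ T) = *-nonNegative (x≤y⇒0≤y-x p≤1) (mass-nonNegative T)

    -- Markov's inequality for the complement of E, in the division-free form that bounds the
    -- probability of the good event E from below. Pointwise, L - X is at most L on E and at most 0
    -- off E.
    markov : ∀ {n e} {E : Pred (Subset n) e} (E? : Decidable E) (X : Subset n → Carrier) L →
      (∀ T → 0# ≤ X T) → (∀ T → ¬ E T → L ≤ X T) → L - expectation X ≤ L * Probability p E?
    markov {n} E? X L 0≤X L≤X = begin
      L - expectation X
          ≈⟨ solve 2 (λ l x → l :- x := con (+ 1) :* l :+ :- con (+ 1) :* x) refl L (expectation X) ⟩
      1# * L + - 1# * expectation X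
          ≈⟨ +-congʳ (*-congˡ (expectation-const n L)) ⟨
      1# * expectation {n} (λ _ → L) + - 1# * expectation X
          ≈⟨ expectation-linear 1# (λ _ → L) (- 1#) X ⟨
      expectation (λ T → 1# * L + - 1# * X T)
          ≤⟨ sumSubsets-mono-≤ pointwise ⟩
      sumSubsets (λ T → L * (if does (E? T) then mass p T else 0#))
          ≈⟨ sumSubsets-scale L (λ T → if does (E? T) then mass p T else 0#) ⟩
      L * Probability p E?   ∎
      where
      pointwise : ∀ T → mass p T * (1# * L + - 1# * X T) ≤ L * (if does (E? T) then mass p T else 0#)
      pointwise T with E? T
      ... | yes _  = ≤-by (*-nonNegative (mass-nonNegative T) (0≤X T))
            (solve 3 (λ m l x → m :* x := l :* m :- m :* (con (+ 1) :* l :+ :- con (+ 1) :* x))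
                refl (mass p T) L (X T))
      ... | no ¬ET = ≤-by (*-nonNegative (mass-nonNegative T) (x≤y⇒0≤y-x (L≤X T ¬ET)))
            (solve 3 (λ m l x → m :* (x :- l) := l :* con (+ 0) :- m :* (con (+ 1) :* l :+ :- con (+ 1) :* x))
                refl (mass p T) L (X T))

-- The deterministic comparison along a unit eigenvector.

module Analysis {a ℓ₁ ℓ₂} (ℝ : CompleteOrderedField a ℓ₁ ℓ₂) where
  open OrderedField ℝ
  open LinearAlgebra ℝ
  open SemiInnerProducts ℝ
  open Maximization ℝ
  open AlgorithmE ℝ
  open AlgorithmProperties ℝ
  open Sampling ℝ
  open Guarantee ℝ

  eigenvector-normalized : ∀ {n} (A : Matrix n n) {μ} → IsEigenvalue A μ →
    ∃ λ v → v ∙ v ≈ 1# × A ⊡ v ≋ (λ i → μ * v i)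
  eigenvector-normalized {n} A {μ} (w , w≉0 , Aw≈μw) = v , sym (trans (sym (*-identityˡ 1#)) (proj₂ v-unit)) ,
      Av≈μv
    where
    0<ww : 0# < w ∙ w
    0<ww with ≈0-or->0 (SemiInnerProduct.nonNegative (dotProduct n) w)
    ... | inj₂ 0<ww = 0<ww
    ... | inj₁ ww≈0 = contradiction (λ i → trans (sym (unit-∙ i w)) (trans (∙-comm (unit i) w)
                        (SemiInnerProduct.null⇒orthogonal (dotProduct n) ww≈0 (unit i)))) w≉0
    root = sqrt (<⇒≤ 0<ww)
    r = proj₁ root
    v : Vector Carrier n
    v i = w i / r
    v-unit : IsUnit v
    v-unit = normalize-isUnit {w = w} {u = v} 0<ww (proj₂ root) (λ _ → refl)
    Av≈μv : A ⊡ v ≋ (λ i → μ * v i)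
    Av≈μv i = begin-equality
      A i ∙ v                          ≈⟨ ∙-cong {x = A i} (λ _ → refl) (λ j → *-comm (w j) (r ⁻¹)) ⟩
      A i ∙ (λ j → r ⁻¹ * w j)         ≈⟨ ∙-scaleʳ (r ⁻¹) w (A i) ⟩
      r ⁻¹ * (A ⊡ w) i                 ≈⟨ *-congˡ (Aw≈μw i) ⟩
      r ⁻¹ * (μ * w i)
          ≈⟨ solve 3 (λ r μ w → r :* (μ :* w) := μ :* (w :* r)) refl (r ⁻¹) μ (w i) ⟩
      μ * v i                          ∎

  module _ {n} (A : Matrix n n) (A-sym : IsSymmetric A) (A-psd : IsPSD A)
           {μ : Carrier} {v : Vector Carrier n} (v-unit : v ∙ v ≈ 1#) (Av≈μv : A ⊡ v ≋ (λ i → μ * v i)) where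
    private
      Af : SemiInnerProduct n
      Af = Aform A A-sym A-psd
      module Af = SemiInnerProduct Af

    eigenvector-form : ∀ x → Af ⟨ x , v ⟩ ≈ μ * (x ∙ v)
    eigenvector-form x = trans (∙-cong {x = x} (λ _ → refl) Av≈μv) (∙-scaleʳ μ v x)

    module _ (0<μ : 0# < μ) where
      -- Cauchy-Schwarz against v in the A-form, where ⟨x,v⟩ = μ(x·v) and ⟨v,v⟩ = μ. It stands in
      -- for the orthogonal splitting: what remains after the v-part is nonnegative.
      μ*component²≤form : ∀ x → μ * ((x ∙ v) * (x ∙ v)) ≤ Af ⟨ x , x ⟩
      μ*component²≤form x = *-cancelˡ-≤ 0<μ (begin
        μ * (μ * (b * b))
            ≈⟨ solve 2 (λ μ b → μ :* (μ :* (b :* b)) := (μ :* b) :* (μ :* b)) refl μ b ⟩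
        (μ * b) * (μ * b)                  ≈⟨ *-cong (eigenvector-form x) (eigenvector-form x) ⟨
        Af ⟨ x , v ⟩ * Af ⟨ x , v ⟩        ≤⟨ Af.cauchy-schwarz x v ⟩
        Af ⟨ x , x ⟩ * Af ⟨ v , v ⟩
            ≈⟨ *-congˡ (trans (eigenvector-form v) (trans (*-congˡ v-unit) (*-identityʳ μ))) ⟩
        Af ⟨ x , x ⟩ * μ                   ≈⟨ *-comm _ μ ⟩
        μ * Af ⟨ x , x ⟩                   ∎)
        where b = x ∙ v

      -- Self-adjointness turns μ(x·v) into (Ax)·v, the component of Ax along the unit vector v.
      [μ*component]²≤square : ∀ x → (μ * (x ∙ v)) * (μ * (x ∙ v)) ≤ (A ⊡ x) ∙ (A ⊡ x)
      [μ*component]²≤square x = begin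
        (μ * (x ∙ v)) * (μ * (x ∙ v))          ≈⟨ *-cong eq eq ⟩
        ((A ⊡ x) ∙ v) * ((A ⊡ x) ∙ v)          ≤⟨ SemiInnerProduct.cauchy-schwarz (dotProduct n) (A ⊡ x) v ⟩
        ((A ⊡ x) ∙ (A ⊡ x)) * (v ∙ v)          ≈⟨ trans (*-congˡ v-unit) (*-identityʳ _) ⟩
        (A ⊡ x) ∙ (A ⊡ x)                      ∎
        where
        eq : μ * (x ∙ v) ≈ (A ⊡ x) ∙ v
        eq = trans (sym (eigenvector-form x)) (⊡-self-adjoint A A-sym A-psd x v)

      module _ {p η : Carrier} (0<η : 0# < η) (η≤μ : η ≤ μ) (d : Vector Carrier n)
               (close : ¬ (η * (p * p) ≤ (1# + 1#) * Af ⟨ d , d ⟩)) where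
        private
          y = lincomb 1# d p v
          b = d ∙ v
          D = Af ⟨ d , d ⟩
          Y = Af ⟨ y , y ⟩
          c = b + p
          -- This is the A-form of y - cv, the part of y orthogonal to v.
          q = Y - μ * (c * c)

          y∙v≈c : y ∙ v ≈ c
          y∙v≈c = trans (∙-linearˡ 1# d p v v) (+-cong (*-identityˡ b) (trans (*-congˡ v-unit) (*-identityʳ p)))

          -- The vectors y and d differ by a multiple of v, so their parts orthogonal to v coincide.
          q≈D-μb² : q ≈ D - μ * (b * b)
          q≈D-μb² = begin-equality
            q                                                    ≈⟨ +-congʳ (Af.norm-lincomb 1# d p v) ⟩
            1# * 1# * D + (1# * p + 1# * p) * Af ⟨ d , v ⟩ + p * p * Af ⟨ v , v ⟩ - μ * (c * c)
                ≈⟨ +-congʳ (+-cong (+-congˡ (*-congˡ (eigenvector-form d)))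
                     (*-congˡ (trans (eigenvector-form v) (trans (*-congˡ v-unit) (*-identityʳ μ))))) ⟩
            1# * 1# * D + (1# * p + 1# * p) * (μ * b) + p * p * μ - μ * (c * c)
                ≈⟨ solve 4 (λ D p μ b → con (+ 1) :* con (+ 1) :* D :+
                    (con (+ 1) :* p :+ con (+ 1) :* p) :* (μ :* b) :+
                     p :* p :* μ :- μ :* ((b :+ p) :* (b :+ p)) := D :- μ :* (b :* b)) refl D p μ b ⟩
            D - μ * (b * b)                                      ∎

          0≤q : 0# ≤ q
          0≤q = x≤y⇒0≤y-x (≤-respˡ-≈ (*-congˡ (*-cong y∙v≈c y∙v≈c)) (μ*component²≤form y))

          -- 2ηc² - 2q = (ηp² - 2D) + 2(μ - η)b² + η(2b + p)², using 2b² + 2(b + p)² - p² = (2b + p)².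
          q<ηc² : q < η * (c * c)
          q<ηc² = ≰⇒> λ ηcc≤q → <⇒≱ 0<2ηc²-2q (≤-by (*-nonNegative 0≤2 (x≤y⇒0≤y-x ηcc≤q))
            (solve 2 (λ q e → (con (+ 1) :+ con (+ 1)) :* (q :- e) :=
                con (+ 0) :- ((con (+ 1) :+ con (+ 1)) :* (e :- q))) refl q (η * (c * c))))
            where
            0≤2 = +-nonNegative 0≤1 0≤1
            0<2ηc²-2q : 0# < (1# + 1#) * (η * (c * c) - q)
            0<2ηc²-2q = <-respʳ-≈ (begin-equality
              _     ≈⟨ solve 5 (λ η p D μ b →
                         (η :* (p :* p) :- (con (+ 1) :+ con (+ 1)) :* D) :+
                         ((con (+ 1) :+ con (+ 1)) :* ((μ :- η) :* (b :* b)) :+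
                             η :* ((b :+ b :+ p) :* (b :+ b :+ p))) :=
                         (con (+ 1) :+ con (+ 1)) :* (η :* ((b :+ p) :* (b :+ p)) :- (D :- μ :* (b :* b))))
                             refl η p D μ b ⟩
              (1# + 1#) * (η * (c * c) - (D - μ * (b * b)))    ≈⟨ *-congˡ (+-congˡ (-‿cong q≈D-μb²)) ⟨
              (1# + 1#) * (η * (c * c) - q)                    ∎)
              (+-positive (x<y⇒0<y-x (≰⇒> close))
                (+-nonNegative (*-nonNegative 0≤2 (*-nonNegative (x≤y⇒0≤y-x η≤μ) (square-nonNegative b)))
                               (*-nonNegative (<⇒≤ 0<η) (square-nonNegative (b + b + p)))))

        -- Makes the restricted eigenvector an admissible competitor, which also rules out the
        -- branch returning an arbitrary vector. If Y ≤ 0, then ηc² ≤ μc² ≤ Y ≤ 0 ≤ q contradicts q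
        -- < ηc².
        shifted-form-positive : 0# < Y
        shifted-form-positive = ≰⇒> λ Y≤0 → <⇒≱ q<ηc² (begin
          η * (c * c)      ≤⟨ *-monoʳ-≤ (square-nonNegative c) η≤μ ⟩
          μ * (c * c)      ≈⟨ *-congˡ (*-cong y∙v≈c y∙v≈c) ⟨
          _                ≤⟨ μ*component²≤form y ⟩
          Y                ≤⟨ Y≤0 ⟩
          0#               ≤⟨ 0≤q ⟩
          q                ∎)

        -- Since Y = μc² + q, the left side equals (μc)² - μ(ηc² - q) - ηq, and both subtracted
        -- terms are nonnegative.
        shifted-rayleigh : (μ - η) * Y ≤ (A ⊡ y) ∙ (A ⊡ y)
        shifted-rayleigh = begin
          (μ - η) * Y
              ≤⟨ ≤-by
                   (+-nonNegative (*-nonNegative (<⇒≤ 0<μ) (x≤y⇒0≤y-x (<⇒≤ q<ηc²)))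
                       (*-nonNegative (<⇒≤ 0<η) 0≤q))
                   (solve 4 (λ μ η Y c → μ :* (η :* (c :* c) :- (Y :- μ :* (c :* c))) :+
                       η :* (Y :- μ :* (c :* c)) :=
                      (μ :* c) :* (μ :* c) :- (μ :- η) :* Y) refl μ η Y c) ⟩
          (μ * c) * (μ * c)                     ≈⟨ *-cong (*-congˡ y∙v≈c) (*-congˡ y∙v≈c) ⟨
          (μ * (y ∙ v)) * (μ * (y ∙ v))         ≤⟨ [μ*component]²≤square y ⟩
          (A ⊡ y) ∙ (A ⊡ y)                     ∎

  -- From the random sample to the success probability.

  module _ (p : Carrier) where
    open RandomSubset ℝ p

    -- The link between algorithm and probability: the left side is v with its coordinates outside T
    -- set to zero, and the right side is its fluctuation around the mean pv.
    selection-restriction : ∀ {n} (T : Subset n) (v : Vector Carrier n) →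
      selection T ⊡ (v ∘ element T) ≋ lincomb 1# (λ i → deviation T i * v i) p v
    selection-restriction (inside ∷ T) v zero = trans
      (+-congˡ (sum-zero λ k → zeroˡ (v (suc (element T k)))))
      (solve 2 (λ p v → con (+ 1) :* v :+ con (+ 0) := con (+ 1) :* ((con (+ 1) :- p) :* v) :+ p :* v)
          refl p (v zero))
    selection-restriction (inside ∷ T) v (suc i) =
        trans (+-cong (zeroˡ _) (selection-restriction T (tail v) i)) (+-identityˡ _)
    selection-restriction (outside ∷ T) v zero = trans
      (sum-zero λ k → zeroˡ (v (suc (element T k))))
      (solve 2 (λ p v → con (+ 0) := con (+ 1) :* (:- p :* v) :+ p :* v) refl p (v zero))
    selection-restriction (outside ∷ T) v (suc i) = selection-restriction T (tail v) i

    module _ {n} (A : Matrix n n) (A-sym : IsSymmetric A) (A-psd : IsPSD A) {v : Vector Carrier n}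
             (v-unit : v ∙ v ≈ 1#) where
      weighted : Subset n → Vector Carrier n
      weighted T i = deviation T i * v i

      deviationForm : Subset n → Carrier
      deviationForm T = quadraticForm A (weighted T)

      -- The weights v are absorbed into the matrix with entries `v i * A i j * v j`, leaving a form
      -- in the bare deviations.
      expectation-deviationForm : expectation deviationForm ≈ p * (1# - p) * sum (λ i → v i * A i i * v i)
      expectation-deviationForm = trans
        (expectation-cong λ T → sum-cong-≋ λ i → begin-equality
          deviation T i * v i * (A i ∙ weighted T)
            ≈⟨ *-assoc _ _ _ ⟩
          deviation T i * (v i * (A i ∙ weighted T))
            ≈⟨ *-congˡ (trans (*-distribˡ-sum (v i) (λ j → A i j * weighted T j)) (sum-cong-≋ λ j →
                 solve 4 (λ v a d w → v :* (a :* (d :* w)) := v :* a :* w :* d) refl (v i) (A i j)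
                     (deviation T j) (v j))) ⟩
          deviation T i * sum (λ j → v i * A i j * v j * deviation T j) ∎)
        (expectation-deviation-form (λ i j → v i * A i j * v j))

      expectation-deviationForm-≤ : 0# ≤ p → p ≤ 1# → (∀ i j → abs (A i j) ≤ 1#) →
          expectation deviationForm ≤ p * (1# - p)
      expectation-deviationForm-≤ 0≤p p≤1 |A|≤1 = begin
        expectation deviationForm                            ≈⟨ expectation-deviationForm ⟩
        p * (1# - p) * sum (λ i → v i * A i i * v i)
            ≤⟨ *-monoˡ-≤ (*-nonNegative 0≤p (x≤y⇒0≤y-x p≤1)) (sum-mono-≤ λ i → begin
          v i * A i i * v i       ≈⟨ solve 2 (λ v a → v :* a :* v := v :* v :* a) refl (v i) (A i i) ⟩
          v i * v i * A i i
              ≤⟨ *-monoˡ-≤ (square-nonNegative (v i)) (≤-trans (Max.x≤x⊔y totalOrder (A i i) (- A i i))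
              (|A|≤1 i i)) ⟩
          v i * v i * 1#          ≈⟨ *-identityʳ _ ⟩
          v i * v i               ∎) ⟩
        p * (1# - p) * (v ∙ v)                               ≈⟨ trans (*-congˡ v-unit) (*-identityʳ _) ⟩
        p * (1# - p)                                         ∎

      failure⇒large-deviation : ∀ {μ η} → A ⊡ v ≋ (λ i → μ * v i) → 0# < η →
        ∀ T u → Returns A T u → ¬ IsUnitWithValue≥ A (μ - η) u → η * (p * p) ≤ (1# + 1#) * deviationForm T
      failure⇒large-deviation {μ} {η} Av≈μv 0<η T u ret fails with η * (p * p) ≤? (1# + 1#) * deviationForm T
      ... | yes large = large
      ... | no  close = contradiction (returns⇒isUnit A A-sym A-psd T ret , value (≤-total μ η)) fails
        where
        x = v ∘ element T
        y = lincomb 1# (weighted T) p v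
        Sx≈y = selection-restriction T v
        ASx≈Ay : AS A T ⊡ x ≋ A ⊡ y
        ASx≈Ay i = trans (AS-⊡ A A-sym A-psd T x i) (⊡-cong A Sx≈y i)

        -- For μ ≤ η the target is at most 0. For η ≤ μ the output is compared with the competitor
        -- x, whose image Sx is y.
        value : μ ≤ η ⊎ η ≤ μ → μ - η ≤ quadraticForm A u
        value (inj₁ μ≤η) = ≤-trans (≤-by (x≤y⇒0≤y-x μ≤η)
          (solve 2 (λ μ η → η :- μ := con (+ 0) :- (μ :- η)) refl μ η)) (A-psd u)
        value (inj₂ η≤μ) = ≤-trans
          (*-≤⇒≤-/ 0<Fx (≤-respˡ-≈ (*-congˡ (sym Fx≈)) (≤-respʳ-≈ (sym (∙-cong ASx≈Ay ASx≈Ay))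
            (shifted-rayleigh A A-sym A-psd v-unit Av≈μv 0<μ 0<η η≤μ (weighted T) close))))
          (returns⇒ratio≤value A A-sym A-psd T ret x 0<Fx)
          where
          0<μ : 0# < μ
          0<μ = <-respʳ-≈ (solve 2 (λ μ η → η :+ (μ :- η) := μ) refl μ η) (+-positive 0<η (x≤y⇒0≤y-x η≤μ))
          Fx≈ : F A A-sym A-psd T ⟨ x , x ⟩ ≈ Aform A A-sym A-psd ⟨ y , y ⟩
          Fx≈ = SemiInnerProduct.cong (Aform A A-sym A-psd) Sx≈y Sx≈y
          0<Fx : 0# < F A A-sym A-psd T ⟨ x , x ⟩
          0<Fx = <-respʳ-≈ (sym Fx≈) (shifted-form-positive A A-sym A-psd v-unit Av≈μv 0<μ 0<η η≤μ
              (weighted T) close)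

      -- Markov's inequality with X = 2dᵀAd and threshold L = ηp². The outputs `u` may be any
      -- admissible choice for each T, because the event of large deviation depends on T and not on
      -- that choice.
      probability-≥ : ∀ {μ η} → A ⊡ v ≋ (λ i → μ * v i) → (∀ i j → abs (A i j) ≤ 1#) →
        0# < η → 0# < p → p ≤ 1# → fromℕ 8 * (1# - p) ≤ η * p →
        (u : Subset n → Vector Carrier n) → (∀ T → Returns A T (u T)) →
        fromℕ 3 / fromℕ 4 ≤ Probability p (λ T → isUnitWithValue≥? A (μ - η) (u T))
      probability-≥ {μ} {η} Av≈μv |A|≤1 0<η 0<p p≤1 8[1-p]≤ηp u ret = ≤-*⇒/-≤ (fromℕ-positive 4)
          (*-cancelˡ-≤ 0<L (≤-by
        (+-nonNegative (+-nonNegative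
          (*-nonNegative (fromℕ-nonNegative 4) (x≤y⇒0≤y-x bound))
          (*-nonNegative (fromℕ-nonNegative 8) (x≤y⇒0≤y-x (expectation-deviationForm-≤ (<⇒≤ 0<p) p≤1 |A|≤1))))
          (*-nonNegative (<⇒≤ 0<p) (x≤y⇒0≤y-x 8[1-p]≤ηp)))
        -- The certificate for 3L ≤ 4LP adds four times the Markov bound, eight times the bound on
        -- the expectation e, and p times the condition on the sampling rate; e cancels. The
        -- numerals are spelled out as `fromℕ` unfolds.
        (solve 4 (λ η p e P →
          let one = con (+ 1); zro = con (+ 0)
              three = one :+ (one :+ (one :+ zro)); four = one :+ three
              eight = one :+ (one :+ (one :+ (one :+ four)))
              l = η :* (p :* p)
          in four :* (l :* P :- (l :- (one :+ one) :* e)) :+ eight :* (p :* (one :- p) :- e) :+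
              p :* (η :* p :- eight :* (one :- p)) :=
             l :* (P :* four) :- l :* three) refl η p (expectation deviationForm) Pr)))
        where
        L = η * (p * p)
        Pr = Probability p (λ T → isUnitWithValue≥? A (μ - η) (u T))
        0<L : 0# < L
        0<L = *-positive 0<η (*-positive 0<p 0<p)
        bound : L - (1# + 1#) * expectation deviationForm ≤ L * Pr
        bound = ≤-respˡ-≈ (+-congˡ (-‿cong (trans
            (sumSubsets-cong λ T → solve 2 (λ m x → m :* ((con (+ 1) :+ con (+ 1)) :* x) :=
                (con (+ 1) :+ con (+ 1)) :* (m :* x)) refl (mass p T) (deviationForm T))
            (sumSubsets-scale (1# + 1#) (λ T → mass p T * deviationForm T)))))
          (markov (<⇒≤ 0<p) p≤1 (λ T → isUnitWithValue≥? A (μ - η) (u T)) (λ T → (1# + 1#) * deviationForm T) L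
            (λ T → *-nonNegative (+-nonNegative 0≤1 0≤1) (A-psd (weighted T)))
            (λ T → failure⇒large-deviation Av≈μv 0<η T (u T) (ret T)))

  module _ {c η : Carrier} (0<c : 0# < c) (0<η : 0# < η) where
    samplingRate : Carrier
    samplingRate = 1# ⊓ (c / η)

    samplingRate-positive : 0# < samplingRate
    samplingRate-positive = [ (λ p≈1 → <-respʳ-≈ (sym p≈1) 0<1)
                            , (λ p≈c/η → <-respʳ-≈ (sym p≈c/η) (*-positive 0<c (⁻¹-positive 0<η)))
                            ]′ (Min.⊓-sel totalOrder 1# (c / η))

    samplingRate≤1 : samplingRate ≤ 1#
    samplingRate≤1 = Min.x⊓y≤x totalOrder 1# (c / η)

    -- One inequality covers both branches of the minimum: at p = 1 the left side vanishes, and at p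
    -- = c/η the right side is c.
    c*[1-samplingRate]≤η*samplingRate : c * (1# - samplingRate) ≤ η * samplingRate
    c*[1-samplingRate]≤η*samplingRate = [ case-1 , case-c/η ]′ (Min.⊓-sel totalOrder 1# (c / η))
      where
      p = samplingRate
      case-1 : p ≈ 1# → c * (1# - p) ≤ η * p
      case-1 p≈1 = begin
        c * (1# - p)     ≈⟨ *-congˡ (+-congˡ (-‿cong p≈1)) ⟩
        c * (1# - 1#)    ≈⟨ trans (*-congˡ (-‿inverseʳ 1#)) (zeroʳ c) ⟩
        0#               ≤⟨ *-nonNegative (<⇒≤ 0<η) (<⇒≤ samplingRate-positive) ⟩
        η * p            ∎
      case-c/η : p ≈ c / η → c * (1# - p) ≤ η * p
      case-c/η p≈c/η = begin
        c * (1# - p)     ≤⟨ ≤-by (*-nonNegative (<⇒≤ 0<c) (<⇒≤ samplingRate-positive))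
                              (solve 2 (λ c p → c :* p := c :- c :* (con (+ 1) :- p)) refl c p) ⟩
        c                ≈⟨ /-*-cancel c (>⇒≉0 0<η) ⟨
        c / η * η        ≈⟨ *-comm _ η ⟩
        η * (c / η)      ≈⟨ *-congˡ p≈c/η ⟨
        η * p            ∎

mainTheorem4 : ∀ {a ℓ₁ ℓ₂} (ℝ : CompleteOrderedField a ℓ₁ ℓ₂) →
    let open CompleteOrderedField ℝ
        open LinearAlgebra ℝ
        open Sampling ℝ
        open AlgorithmE ℝ
        open Guarantee ℝ
    in
    ∃ λ (c : Carrier) → 0# < c ×
      (∀ (n : ℕ) .{{_ : NonZero n}} (ε : Carrier) → 0# < ε → ε < 1# →
       ∀ (A : Matrix n n) → IsSymmetric A → IsPSD A →
       (∀ i j → abs (A i j) ≤ 1#) →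
       ∀ (λ₁ : Carrier) → IsLargestEigenvalue A λ₁ →
       let p = 1# ⊓ (c / (ε * fromℕ n)) in
       (∀ (T : Subset n) → ∃ λ (u : Vector Carrier n) → Returns A T u) ×
       (∀ (u : Subset n → Vector Carrier n) → (∀ T → Returns A T (u T)) →
        fromℕ 3 / fromℕ 4 ≤
          Probability p (λ T → isUnitWithValue≥? A (λ₁ - ε * fromℕ n) (u T))))
mainTheorem4 ℝ = fromℕ 8 , fromℕ-positive 8 , λ n ε 0<ε ε<1 A A-sym A-psd |A|≤1 λ₁ (λ₁-eigenvalue , _) →
  let 0<8 = fromℕ-positive 8
      0<η = *-positive 0<ε (fromℕ-positive n)
      v , v-unit , Av≈λ₁v = eigenvector-normalized A λ₁-eigenvalue
  in (λ T → returns-exists A A-sym A-psd T) ,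
     probability-≥ _ A A-sym A-psd v-unit Av≈λ₁v |A|≤1 0<η (samplingRate-positive 0<8 0<η)
       (samplingRate≤1 0<8 0<η) (c*[1-samplingRate]≤η*samplingRate 0<8 0<η)
  where
  open OrderedField ℝ
  open Analysis ℝ
  open AlgorithmProperties ℝ
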